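{- For every constant $\epsilon>0$, the flow LP for Constrained Connectivity-Sum has an integrality gap of $\Omega(n^{\frac13-\epsilon})$; that is, there are instances with $n$ vertices (for arbitrarily large $n$) on which the minimum number of edges of a safely connected subgraph is $\Omega(n^{\frac13-\epsilon})$ times the optimal value of the flow LP.
   Context: Constrained Connectivity: given a graph $G=(V,E)$, $n=|V|$, and for each ordered pair $(u,v)\in V\times V$ a set $S(u,v)\subseteq V$ with $u,v\in S(u,v)$. A subgraph $H$ of $G$ is safely connected if for every ordered pair $(u,v)$ there is a $u$–$v$ path in $H$ all of whose vertices lie in $S(u,v)$; Constrained Connectivity-Sum minimizes the number of edges of $H$. Let $\mathcal{P}_{uv}$ be the set of $u$–$v$ paths in $G$ contained in $S(u,v)$. The flow LP: minimize $\sum_{e\in E}c_e$ subject to $\sum_{P\in\mathcal{P}_{uv}}f(P)\ge1$ for all $(u,v)$; $\sum_{P\in\mathcal{P}_{uv}:e\in P}f(P)\le c_e$ for all $e\in E$ and all $(u,v)$; $0\le c_e\le1$; $0\le f(P)\le1$. -}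

module Defs where

open import Data.Nat as ℕ using (ℕ; zero; suc)
open import Data.Integer using (+_)
open import Data.Rational as ℚ using (ℚ; 0ℚ; 1ℚ; _/_; _≤_; Positive)
import Data.Fin
open import Data.Fin using (Fin; toℕ) renaming (_≟_ to _≟ᶠ_)
open import Data.Fin.Subset using (Subset; _∈_)
open import Data.Bool using (Bool; true; false; _∧_; _∨_; if_then_else_)
open import Data.List using (List; []; _∷_; map; head; last)
open import Data.List.Relation.Unary.All using (All)
open import Data.List.Relation.Unary.Unique.Propositional using (Unique)
open import Data.Maybe using (Maybe; just)
open import Data.Product using (Σ; _×_; _,_; proj₁; proj₂; ∃)
open import Data.Unit using (⊤)
open import Relation.Binary.PropositionalEquality using (_≡_)
open import Relation.Nullary.Decidable using (⌊_⌋)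

ℕ→ℚ : ℕ → ℚ
ℕ→ℚ k = (+ k) / 1

_^ℚ_ : ℚ → ℕ → ℚ
q ^ℚ zero  = 1ℚ
q ^ℚ suc k = q ℚ.* (q ^ℚ k)

sumFin : {n : ℕ} → (Fin n → ℚ) → ℚ
sumFin {zero}  f = 0ℚ
sumFin {suc n} f = f Data.Fin.zero ℚ.+ sumFin (λ i → f (Data.Fin.suc i))

sumFinℕ : {n : ℕ} → (Fin n → ℕ) → ℕ
sumFinℕ {zero}  f = 0
sumFinℕ {suc n} f = f Data.Fin.zero ℕ.+ sumFinℕ (λ i → f (Data.Fin.suc i))

sumℚ : List ℚ → ℚ
sumℚ []       = 0ℚ
sumℚ (x ∷ xs) = x ℚ.+ sumℚ xs

Adj : ℕ → Set
Adj n = Fin n → Fin n → Bool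

isEdge : {n : ℕ} → Adj n → Fin n → Fin n → Bool
isEdge K i j = K i j ∧ (toℕ i ℕ.<ᵇ toℕ j)

edgeCount : {n : ℕ} → Adj n → ℕ
edgeCount K = sumFinℕ (λ i → sumFinℕ (λ j → if isEdge K i j then 1 else 0))

record Instance : Set where
  field
    n       : ℕ
    G       : Adj n
    G-sym   : ∀ i j → G i j ≡ G j i
    G-irr   : ∀ i → G i i ≡ false
    S       : Fin n → Fin n → Subset n
    S-fst   : ∀ u v → u ∈ S u v
    S-snd   : ∀ u v → v ∈ S u v

Consec : {n : ℕ} → Adj n → List (Fin n) → Set
Consec K []            = ⊤
Consec K (x ∷ [])      = ⊤
Consec K (x ∷ y ∷ r)   = (K x y ≡ true) × Consec K (y ∷ r)

IsPath : {n : ℕ} → Adj n → Subset n → Fin n → Fin n → List (Fin n) → Set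
IsPath K T u v P =
  (head P ≡ just u) × (last P ≡ just v) × Unique P × Consec K P × All (_∈ T) P

usesEdge : {n : ℕ} → Fin n → Fin n → List (Fin n) → Bool
usesEdge i j []          = false
usesEdge i j (x ∷ [])    = false
usesEdge i j (x ∷ y ∷ r) =
  (⌊ x ≟ᶠ i ⌋ ∧ ⌊ y ≟ᶠ j ⌋) ∨ (⌊ x ≟ᶠ j ⌋ ∧ ⌊ y ≟ᶠ i ⌋) ∨ usesEdge i j (y ∷ r)

module _ (I : Instance) where
  open Instance I

  IsSubgraph : Adj n → Set
  IsSubgraph H = (∀ i j → H i j ≡ H j i) × (∀ i j → H i j ≡ true → G i j ≡ true)

  SafelyConnected : Adj n → Set
  SafelyConnected H = ∀ u v → ∃ λ P → IsPath H (S u v) u v P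

  -- a flow for the pair (u,v): a finitely supported function f on P_uv,
  -- given as a list of (path, value) pairs with distinct paths
  -- (paths not in the list have f(P) = 0)
  FlowList : Set
  FlowList = List (List (Fin n) × ℚ)

  load : Fin n → Fin n → FlowList → ℚ
  load i j fl = sumℚ (map (λ pw → if usesEdge i j (proj₁ pw) then proj₂ pw else 0ℚ) fl)

  -- LP objective  Σ_{e ∈ E} c_e   (edge {i,j} stored at c i j with i < j)
  lpValue : (Fin n → Fin n → ℚ) → ℚ
  lpValue c = sumFin (λ i → sumFin (λ j → if isEdge G i j then c i j else 0ℚ))

  LPFeasible : (Fin n → Fin n → ℚ) → (Fin n → Fin n → FlowList) → Set
  LPFeasible c f =
    (∀ i j → isEdge G i j ≡ true → (0ℚ ≤ c i j) × (c i j ≤ 1ℚ)) ×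
    (∀ u v → Unique (map proj₁ (f u v))) ×
    (∀ u v → All (λ pw → IsPath G (S u v) u v (proj₁ pw) × (0ℚ ≤ proj₂ pw) × (proj₂ pw ≤ 1ℚ)) (f u v)) ×
    (∀ u v → 1ℚ ≤ sumℚ (map proj₂ (f u v))) ×
    (∀ u v i j → isEdge G i j ≡ true → load i j (f u v) ≤ c i j)

{-# OPTIONS --safe #-}

-- Take two families of m groups of k labels, where label x of group i on the left is joined to label x + s i j of
-- group j on the right (mod k) for random shifts s i j, and k terminals per group; a demand between a left and a
-- right terminal of equal index may only pass through the labels of their two groups. Spreading every terminal
-- evenly over its k labels, together with a hub serving all other pairs, costs O(n). If half of the groups on
-- each side use at most d = √(k/L) labels, then m²/4 shifts are differences of two chosen labels, each with
-- probability d²/k = 1/L; for m of order d log_L k this beats the k^(2md) choices of labels. Hence every integral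
-- solution has Ω(kmd) edges while n = O(km), a gap of order d. For k = L^(2b+1) and d = L^b the number n is of
-- order L^(3b+1), so d is at least n^(1/3 - ε) up to constants as soon as ε ≥ 1/b.
module Submission where

open import Defs
open import Data.Nat using (ℕ; _<_; _≤_; _*_)
open import Data.Rational using (ℚ; Positive) renaming (_≤_ to _≤ℚ_; _*_ to _*ℚ_)
open import Data.Product using (Σ; _×_; ∃)
open import Data.Fin using (Fin)

open import Algebra.Properties.CommutativeSemigroup using (interchange)
import Algebra.Properties.Semiring.Sum
open import Data.Bool using (Bool; true; false; _∧_; _∨_; if_then_else_; T)
open import Data.Bool.Properties using (∨-comm; ∨-zeroʳ; ∨-identityʳ; ∧-conicalˡ; ∧-conicalʳ; T-≡)
open import Data.Empty using (⊥-elim)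
open import Data.Fin using (zero; suc; toℕ; combine; remQuot; funToFin; finToFun; _↑ˡ_; _↑ʳ_) renaming (_≟_ to _≟ᶠ_)
open import Data.Fin.Patterns
import Data.Fin.Properties as Fin
open import Data.Fin.Properties using (remQuot-combine; combine-remQuot; combine-monoˡ-<; finToFun-funToFin;
                                       toℕ-fromℕ<; toℕ<n; toℕ-injective; any?)
open import Data.Fin.Subset using (Subset; _∈_)
import Data.Integer as ℤ
import Data.Integer.Properties as ℤ
open import Data.List using (List; []; _∷_; map; last; tabulate)
open import Data.List.Properties using (map-tabulate; ∷-injectiveˡ; ∷-injectiveʳ)
open import Data.List.Relation.Unary.All using (All; []; _∷_)
import Data.List.Relation.Unary.All.Properties as All
open import Data.List.Relation.Unary.AllPairs using ([]; _∷_)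
open import Data.List.Relation.Unary.Unique.Propositional using (Unique)
import Data.List.Relation.Unary.Unique.Propositional.Properties as Unique
open import Data.Maybe using (Maybe; just; nothing; maybe′)
open import Data.Nat using (zero; suc; _+_; _∸_; _^_; _≤ᵇ_; z≤n; s≤s; NonZero; >-nonZero; >-nonZero⁻¹)
open import Data.Nat.DivMod using (_mod_; _%_; %-distribˡ-+; m<n⇒m%n≡m; [m+n]%n≡m%n; m%n%n≡m%n)
open import Data.Nat.Properties
open import Data.Nat.Solver using (module +-*-Solver)
open import Data.Product using (∃₂; _,_; proj₁; proj₂; uncurry)
open import Data.Rational as ℚ using (0ℚ; 1ℚ; 1/_; NonNegative; toℚᵘ) renaming (_+_ to _+ℚ_)
import Data.Rational.Properties as ℚ
import Data.Rational.Unnormalised as ℚᵘ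
import Data.Rational.Unnormalised.Properties as ℚᵘ
open import Data.Sum using (_⊎_; inj₁; inj₂)
import Data.Vec as Vec
open import Data.Vec.Functional using (foldr)
open import Data.Vec.Properties using (lookup∘tabulate; lookup⇒[]=; []=⇒lookup)
open import Function using (_∘_; Equivalence)
open import Relation.Binary.PropositionalEquality using (_≡_; _≢_; refl; sym; trans; cong; cong₂; subst; subst₂;
                                                         module ≡-Reasoning)
open import Relation.Nullary using (yes; no; contradiction)
open import Relation.Nullary.Decidable using (⌊_⌋)

open Algebra.Properties.Semiring.Sum +-*-semiring
  using (sum; sum-syntax; sum-cong-≗; ∑-distrib-+; ∑-comm; *-distribˡ-sum; *-distribʳ-sum)

-- Finite sums and counting.

𝟙 : Bool → ℕ
𝟙 b = if b then 1 else 0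

count : ∀ {n} → (Fin n → Bool) → ℕ
count p = sum (𝟙 ∘ p)

sumFinℕ≡sum : ∀ {n} (f : Fin n → ℕ) → sumFinℕ f ≡ sum f
sumFinℕ≡sum {zero}  f = refl
sumFinℕ≡sum {suc n} f = cong (f zero +_) (sumFinℕ≡sum (f ∘ suc))

sum-const : ∀ n c → ∑[ i < n ] c ≡ n * c
sum-const zero    c = refl
sum-const (suc n) c = cong (c +_) (sum-const n c)

sum-mono-≤ : ∀ {n} {f g : Fin n → ℕ} → (∀ i → f i ≤ g i) → sum f ≤ sum g
sum-mono-≤ {zero}  f≤g = z≤n
sum-mono-≤ {suc n} f≤g = +-mono-≤ (f≤g zero) (sum-mono-≤ (f≤g ∘ suc))

sum-≤-const : ∀ {n} {f : Fin n → ℕ} {c} → (∀ i → f i ≤ c) → sum f ≤ n * c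
sum-≤-const {n} {c = c} f≤c = ≤-trans (sum-mono-≤ f≤c) (≤-reflexive (sum-const n c))

sum-≥-const : ∀ {n} {f : Fin n → ℕ} {c} → (∀ i → c ≤ f i) → n * c ≤ sum f
sum-≥-const {n} {c = c} c≤f = ≤-trans (≤-reflexive (sym (sum-const n c))) (sum-mono-≤ c≤f)

term≤sum : ∀ {n} (f : Fin n → ℕ) i → f i ≤ sum f
term≤sum f zero    = m≤m+n _ _
term≤sum f (suc i) = ≤-trans (term≤sum (f ∘ suc) i) (m≤n+m _ _)

sum-↑ : ∀ a {b} (f : Fin (a + b) → ℕ) → sum f ≡ ∑[ i < a ] f (i ↑ˡ b) + ∑[ j < b ] f (a ↑ʳ j)
sum-↑ zero    f = refl
sum-↑ (suc a) f = trans (cong (f zero +_) (sum-↑ a (f ∘ suc))) (sym (+-assoc (f zero) _ _))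

sum-combine : ∀ a {b} (f : Fin (a * b) → ℕ) → sum f ≡ ∑[ i < a ] ∑[ j < b ] f (combine i j)
sum-combine zero        f = refl
sum-combine (suc a) {b} f = trans (sum-↑ b f) (cong (∑[ j < b ] f (j ↑ˡ a * b) +_) (sum-combine a (f ∘ (b ↑ʳ_))))

count-none : ∀ {n} (p : Fin n → Bool) → (∀ i → p i ≢ true) → count p ≡ 0
count-none {zero}  p none = refl
count-none {suc n} p none with p zero in eq
... | true  = ⊥-elim (none zero eq)
... | false = count-none (p ∘ suc) (none ∘ suc)

count-unique : ∀ {n} (p : Fin n → Bool) → (∀ i j → p i ≡ true → p j ≡ true → i ≡ j) → count p ≤ 1
count-unique {zero}  p uniq = z≤n
count-unique {suc n} p uniq with p zero in eq
... | true  = ≤-reflexive (cong suc (count-none (p ∘ suc) λ i pi → Fin.0≢1+n (uniq zero (suc i) eq pi)))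
... | false = count-unique (p ∘ suc) λ i j pi pj → Fin.suc-injective (uniq (suc i) (suc j) pi pj)

isYes-true : ∀ {n} {x y : Fin n} → ⌊ x ≟ᶠ y ⌋ ≡ true → x ≡ y
isYes-true {x = x} {y} e with x ≟ᶠ y
... | yes x≡y = x≡y

isYes-refl : ∀ {n} {x y : Fin n} → x ≡ y → ⌊ x ≟ᶠ y ⌋ ≡ true
isYes-refl {x = x} {y} e with x ≟ᶠ y
... | yes _   = refl
... | no  x≢y = ⊥-elim (x≢y e)

-- Double counting of the pairs `(j , y)` with `h y ≡ j`: every counted `j` occurs in at least one
-- of them and every `y` in at most one.
count-≤-cover : ∀ {n k} (p : Fin n → Bool) (h : Fin k → Fin n) →
                (∀ j → p j ≡ true → ∃ λ y → h y ≡ j) → count p ≤ k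
count-≤-cover {n} {k} p h cover = begin
  count p                               ≤⟨ sum-mono-≤ hit ⟩
  ∑[ j < n ] ∑[ y < k ] 𝟙 ⌊ h y ≟ᶠ j ⌋  ≡⟨ ∑-comm (λ j y → 𝟙 ⌊ h y ≟ᶠ j ⌋) ⟩
  ∑[ y < k ] ∑[ j < n ] 𝟙 ⌊ h y ≟ᶠ j ⌋  ≤⟨ sum-≤-const (λ y → count-unique (λ j → ⌊ h y ≟ᶠ j ⌋)
                                                   λ i j e e′ → trans (sym (isYes-true e)) (isYes-true e′)) ⟩
  k * 1  ≡⟨ *-identityʳ k ⟩
  k      ∎
  where
  open ≤-Reasoning
  hit : ∀ j → 𝟙 (p j) ≤ ∑[ y < k ] 𝟙 ⌊ h y ≟ᶠ j ⌋
  hit j with p j in eq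
  ... | false = z≤n
  ... | true  = let y , hy≡j = cover j eq in
    ≤-trans (≤-reflexive (cong 𝟙 (sym (isYes-refl hy≡j)))) (term≤sum (λ y → 𝟙 ⌊ h y ≟ᶠ j ⌋) y)

-- The list has the fixed length `d`, padded with `x₀`, so that sets of at most `d` labels become
-- functions on `Fin d` and can be counted.
enumerate : ∀ {X : Set} {n} (p : Fin n → Bool) (f : Fin n → X) (x₀ : X) d → count p ≤ d →
            Σ (Fin d → X) λ A → ∀ j → p j ≡ true → ∃ λ q → A q ≡ f j
enumerate {n = zero}  p f x₀ d _ = (λ _ → x₀) , λ ()
enumerate {X} {n = suc n} p f x₀ d c≤d with p zero in eq
... | false = let A , hits = enumerate (p ∘ suc) (f ∘ suc) x₀ d c≤d in
  A , λ { zero p0 → contradiction (trans (sym eq) p0) λ () ; (suc j) pj → hits j pj }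
... | true with s≤s c≤d′ ← c≤d = let A , hits = enumerate (p ∘ suc) (f ∘ suc) x₀ _ c≤d′ in
  cons A , λ { zero _ → zero , refl ; (suc j) pj → let q , e = hits j pj in suc q , e }
  where
  cons : ∀ {e} → (Fin e → X) → Fin (suc e) → X
  cons A zero    = f zero
  cons A (suc q) = A q

average : ∀ k .{{_ : NonZero k}} (f : Fin k → ℕ) c → sum f ≤ k * c → ∃ λ i → f i ≤ c
average k f c f≤ with any? (λ i → f i ≤? c)
... | yes found = found
... | no  none  = ⊥-elim (<⇒≱ (*-monoʳ-< k ≤-refl) (≤-trans (sum-≥-const (λ i → ≰⇒> λ fi≤c → none (i , fi≤c))) f≤))

-- Products and derandomisation.

product : ∀ {n} → (Fin n → ℕ) → ℕ
product = foldr _*_ 1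

^count≤product : ∀ {n} L (p : Fin n → Bool) (g : Fin n → ℕ) →
                 (∀ i → 1 ≤ g i) → (∀ i → p i ≡ true → L ≤ g i) → L ^ count p ≤ product g
^count≤product {zero}  L p g 1≤g L≤g = ≤-refl
^count≤product {suc n} L p g 1≤g L≤g with p zero in eq
... | true  = *-mono-≤ (L≤g zero eq) (^count≤product L (p ∘ suc) (g ∘ suc) (1≤g ∘ suc) (L≤g ∘ suc))
... | false = ≤-trans (≤-reflexive (sym (*-identityˡ _)))
                (*-mono-≤ (1≤g zero) (^count≤product L (p ∘ suc) (g ∘ suc) (1≤g ∘ suc) (L≤g ∘ suc)))

-- The method of conditional expectations, for the weighted sum over z of a product of independent factors.
derandomise : ∀ {N k} .{{_ : NonZero k}} M c (w : Fin N → ℕ) (g : Fin N → Fin M → Fin k → ℕ) →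
              (∀ z e → sum (g z e) ≤ k * c) →
              ∃ λ (s : Fin M → Fin k) → ∑[ z < N ] (w z * product (λ e → g z e (s e))) ≤ c ^ M * sum w
derandomise zero    c w g avg = (λ ()) , ≤-reflexive
  (trans (sum-cong-≗ (λ z → *-identityʳ (w z))) (sym (*-identityˡ _)))
derandomise {N} {k} (suc M) c w g avg = cons , (begin
  ∑[ z < N ] (w z * (g z zero s₀ * product (λ e → g z (suc e) (s e))))  ≡⟨ sum-cong-≗ (λ z → sym (*-assoc (w z) _ _)) ⟩
  ∑[ z < N ] (w z * g z zero s₀ * product (λ e → g z (suc e) (s e)))    ≤⟨ s≤ ⟩
  c ^ M * ∑[ z < N ] (w z * g z zero s₀)                                ≤⟨ *-monoʳ-≤ (c ^ M) s₀≤ ⟩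
  c ^ M * (c * sum w)                                                   ≡⟨ sym (*-assoc (c ^ M) c _) ⟩
  c ^ M * c * sum w                                                     ≡⟨ cong (_* sum w) (*-comm (c ^ M) c) ⟩
  c ^ suc M * sum w                                                     ∎)
  where
  open ≤-Reasoning
  mean : ∑[ t < k ] ∑[ z < N ] (w z * g z zero t) ≤ k * (c * sum w)
  mean = begin
    ∑[ t < k ] ∑[ z < N ] (w z * g z zero t)  ≡⟨ ∑-comm (λ t z → w z * g z zero t) ⟩
    ∑[ z < N ] ∑[ t < k ] (w z * g z zero t)  ≡⟨ sum-cong-≗ (λ z → sym (*-distribˡ-sum (w z) (g z zero))) ⟩
    ∑[ z < N ] (w z * sum (g z zero))         ≤⟨ sum-mono-≤ (λ z → *-monoʳ-≤ (w z) (avg z zero)) ⟩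
    ∑[ z < N ] (w z * (k * c))                ≡⟨ sum-cong-≗ (λ z → *-comm (w z) (k * c)) ⟩
    ∑[ z < N ] (k * c * w z)                  ≡⟨ sym (*-distribˡ-sum (k * c) w) ⟩
    k * c * sum w                             ≡⟨ *-assoc k c _ ⟩
    k * (c * sum w)                           ∎
  -- Some value of the first coordinate does no worse than the average. Its factor moves into the
  -- weights, and the recursion fixes the remaining coordinates.
  first = average k (λ t → ∑[ z < N ] (w z * g z zero t)) (c * sum w) mean
  s₀ = proj₁ first
  s₀≤ = proj₂ first
  rest = derandomise M c (λ z → w z * g z zero s₀) (λ z e → g z (suc e)) (λ z e → avg z (suc e))
  s = proj₁ rest
  s≤ = proj₂ rest
  cons : Fin (suc M) → Fin k
  cons zero    = s₀
  cons (suc e) = s e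

-- Addition modulo `k`.

module _ {k} .{{_ : NonZero k}} where

  infixl 6 _⊕_
  _⊕_ : Fin k → Fin k → Fin k
  x ⊕ s = (toℕ x + toℕ s) mod k

  ⊕-comm : ∀ x s → x ⊕ s ≡ s ⊕ x
  ⊕-comm x s = cong (_mod k) (+-comm (toℕ x) (toℕ s))

  toℕ-⊕ : ∀ x s → toℕ (x ⊕ s) ≡ (toℕ x + toℕ s) % k
  toℕ-⊕ x s = toℕ-fromℕ< _

  -- Adding the complement `k ∸ toℕ x` undoes adding `x` modulo `k`; this exhibits `s` as a function
  -- of `x ⊕ s` and yields cancellation.
  ⊕-retract : ∀ x s → (k ∸ toℕ x + toℕ (x ⊕ s)) % k ≡ toℕ s
  ⊕-retract x s = begin
    (k ∸ toℕ x + toℕ (x ⊕ s)) % k                    ≡⟨ cong (λ t → (k ∸ toℕ x + t) % k) (toℕ-⊕ x s) ⟩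
    (k ∸ toℕ x + (toℕ x + toℕ s) % k) % k            ≡⟨ %-distribˡ-+ (k ∸ toℕ x) _ k ⟩
    ((k ∸ toℕ x) % k + (toℕ x + toℕ s) % k % k) % k  ≡⟨ cong (λ t → ((k ∸ toℕ x) % k + t) % k) (m%n%n≡m%n (toℕ x + toℕ s) k) ⟩
    ((k ∸ toℕ x) % k + (toℕ x + toℕ s) % k) % k      ≡⟨ sym (%-distribˡ-+ (k ∸ toℕ x) _ k) ⟩
    (k ∸ toℕ x + (toℕ x + toℕ s)) % k                ≡⟨ cong (_% k) (sym (+-assoc (k ∸ toℕ x) _ _)) ⟩
    (k ∸ toℕ x + toℕ x + toℕ s) % k                  ≡⟨ cong (λ t → (t + toℕ s) % k) (m∸n+n≡m (<⇒≤ (toℕ<n x))) ⟩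
    (k + toℕ s) % k                                  ≡⟨ cong (_% k) (+-comm k (toℕ s)) ⟩
    (toℕ s + k) % k                                  ≡⟨ [m+n]%n≡m%n (toℕ s) k ⟩
    toℕ s % k                                        ≡⟨ m<n⇒m%n≡m (toℕ<n s) ⟩
    toℕ s                                            ∎
    where open ≡-Reasoning

  ⊕-cancelˡ : ∀ x {s t} → x ⊕ s ≡ x ⊕ t → s ≡ t
  ⊕-cancelˡ x {s} {t} e = toℕ-injective (trans (sym (⊕-retract x s))
    (trans (cong (λ y → (k ∸ toℕ x + toℕ y) % k) e) (⊕-retract x t)))

  ⊕-cancelʳ : ∀ s {x y} → x ⊕ s ≡ y ⊕ s → x ≡ y
  ⊕-cancelʳ s {x} {y} e = ⊕-cancelˡ s (trans (⊕-comm s x) (trans e (⊕-comm y s)))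

-- Shifts that force many labels.

markov : ∀ h d (c : Fin (h + h) → ℕ) → count (λ i → c i ≤ᵇ d) < h → h * d ≤ sum c
markov h d c few = +-cancelʳ-≤ (d * h) _ _ (begin
  h * d + d * h                              ≡⟨ cong (h * d +_) (*-comm d h) ⟩
  h * d + h * d                              ≡⟨ sym (*-distribʳ-+ d h h) ⟩
  -- Markov's inequality: each term with `c i ≤ d` is topped up by `d`. Fewer than `h` of the `2h`
  -- terms need this, which leaves `h * d` for the sum.
  (h + h) * d                                ≤⟨ sum-≥-const each ⟩
  ∑[ i < h + h ] (c i + d * 𝟙 (c i ≤ᵇ d))    ≡⟨ ∑-distrib-+ c _ ⟩
  sum c + ∑[ i < h + h ] (d * 𝟙 (c i ≤ᵇ d))  ≡⟨ cong (sum c +_) (sym (*-distribˡ-sum d (λ i → 𝟙 (c i ≤ᵇ d)))) ⟩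
  sum c + d * count (λ i → c i ≤ᵇ d)         ≤⟨ +-monoʳ-≤ (sum c) (*-monoʳ-≤ d (<⇒≤ few)) ⟩
  sum c + d * h                              ∎)
  where
  open ≤-Reasoning
  each : ∀ i → d ≤ c i + d * 𝟙 (c i ≤ᵇ d)
  each i with c i ≤ᵇ d in eq
  ... | true  = ≤-trans (≤-reflexive (sym (*-identityʳ d))) (m≤n+m (d * 1) (c i))
  ... | false = ≤-trans (<⇒≤ (≰⇒> λ le → subst T eq (≤⇒≤ᵇ {c i} le))) (m≤m+n (c i) _)

-- `Ld²≤k` keeps the average of each factor at most 2. `large` is the union bound: 2 to the number
-- of group pairs, times the number of pairs of codes, stays below the product forced by `h * h`
-- pairs of light groups.
module Shifts {k} .{{_ : NonZero k}} (L d h : ℕ) .{{_ : NonZero L}} (Ld²≤k : L * (d * d) ≤ k)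
  (large : 2 ^ ((h + h) * (h + h)) * (k ^ ((h + h) * d) * k ^ ((h + h) * d)) < L ^ (h * h)) where

  m N : ℕ
  m = h + h
  N = k ^ (m * d)

  matches : (A B : Fin d → Fin k) → Fin k → ℕ
  matches A B s = ∑[ p < d ] ∑[ q < d ] 𝟙 ⌊ A p ⊕ s ≟ᶠ B q ⌋

  -- For fixed positions `p` and `q`, cancellation leaves at most one shift carrying `A p` to `B q`,
  -- so each of the `d * d` pairs of positions contributes at most 1.
  sum-matches : ∀ A B → sum (matches A B) ≤ d * d
  sum-matches A B = begin
    ∑[ s < k ] ∑[ p < d ] ∑[ q < d ] 𝟙 ⌊ A p ⊕ s ≟ᶠ B q ⌋
      ≡⟨ ∑-comm (λ s p → ∑[ q < d ] 𝟙 ⌊ A p ⊕ s ≟ᶠ B q ⌋) ⟩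
    ∑[ p < d ] ∑[ s < k ] ∑[ q < d ] 𝟙 ⌊ A p ⊕ s ≟ᶠ B q ⌋
      ≡⟨ sum-cong-≗ (λ p → ∑-comm (λ s q → 𝟙 ⌊ A p ⊕ s ≟ᶠ B q ⌋)) ⟩
    ∑[ p < d ] ∑[ q < d ] ∑[ s < k ] 𝟙 ⌊ A p ⊕ s ≟ᶠ B q ⌋
      ≤⟨ sum-≤-const (λ p → sum-≤-const (λ q → count-unique (λ s → ⌊ A p ⊕ s ≟ᶠ B q ⌋) λ s t e e′ →
           ⊕-cancelˡ (A p) (trans (isYes-true e) (sym (isYes-true e′))))) ⟩
    d * (d * 1)
      ≡⟨ cong (d *_) (*-identityʳ d) ⟩
    d * d ∎
    where open ≤-Reasoning

  1≤matches : ∀ A B s p q → A p ⊕ s ≡ B q → 1 ≤ matches A B s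
  1≤matches A B s p q e = begin
    1                                ≡⟨ cong 𝟙 (sym (isYes-refl e)) ⟩
    𝟙 ⌊ A p ⊕ s ≟ᶠ B q ⌋             ≤⟨ term≤sum (λ q → 𝟙 ⌊ A p ⊕ s ≟ᶠ B q ⌋) q ⟩
    ∑[ q < d ] 𝟙 ⌊ A p ⊕ s ≟ᶠ B q ⌋  ≤⟨ term≤sum (λ p → ∑[ q < d ] 𝟙 ⌊ A p ⊕ s ≟ᶠ B q ⌋) p ⟩
    matches A B s                    ∎
    where open ≤-Reasoning

  -- A code is a single number that holds a list of `d` labels for each of the `m` groups of one
  -- side, so a union bound over label choices is a sum over `Fin N`.
  decode : Fin N → Fin m → Fin d → Fin k
  decode z i p = finToFun z (combine i p)

  encode : (Fin m → Fin d → Fin k) → Fin N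
  encode A = funToFin (λ e → uncurry A (remQuot d e))

  decode-encode : ∀ A i p → decode (encode A) i p ≡ A i p
  decode-encode A i p = trans (finToFun-funToFin (λ e → uncurry A (remQuot d e)) (combine i p))
    (cong (uncurry A) (remQuot-combine i p))

  -- On average over the shift at most 2, but larger than L as soon as the shift is a difference of chosen labels.
  factorAt : Fin N × Fin N → Fin m × Fin m → Fin k → ℕ
  factorAt (y , z) (i , j) s = 1 + L * matches (decode y i) (decode z j) s

  factor : Fin (N * N) → Fin (m * m) → Fin k → ℕ
  factor z e = factorAt (remQuot N z) (remQuot m e)

  mean-factor : ∀ z e → sum (factor z e) ≤ k * 2
  mean-factor z e = begin
    ∑[ s < k ] (1 + L * f s)             ≡⟨ ∑-distrib-+ (λ _ → 1) (λ s → L * f s) ⟩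
    ∑[ s < k ] 1 + ∑[ s < k ] (L * f s)  ≡⟨ cong₂ _+_ (sum-const k 1) (sym (*-distribˡ-sum L f)) ⟩
    k * 1 + L * sum f                    ≤⟨ +-mono-≤ (≤-reflexive (*-identityʳ k)) (≤-trans (*-monoʳ-≤ L (sum-matches _ _)) Ld²≤k) ⟩
    k + k                                ≡⟨ cong (k +_) (sym (+-identityʳ k)) ⟩
    2 * k                                ≡⟨ *-comm 2 k ⟩
    k * 2                                ∎
    where
    open ≤-Reasoning
    f : Fin k → ℕ
    f = matches (decode (proj₁ (remQuot {N} N z)) (proj₁ (remQuot {m} m e)))
                (decode (proj₂ (remQuot {N} N z)) (proj₂ (remQuot {m} m e)))

  abstract
    chosen : ∃ λ (s : Fin (m * m) → Fin k) →
             ∑[ z < N * N ] (1 * product (λ e → factor z e (s e))) ≤ 2 ^ (m * m) * ∑[ z < N * N ] 1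
    chosen = derandomise (m * m) 2 (λ _ → 1) factor mean-factor

  shift : Fin m → Fin m → Fin k
  shift i j = proj₁ chosen (combine i j)

  -- A single term is at most the sum over all pairs of codes, which the chosen shifts keep at its
  -- average level or below. Hence no choice of label lists has matches at `h * h` pairs of groups.
  few-covered : ∀ z → product (λ e → factor z e (proj₁ chosen e)) < L ^ (h * h)
  few-covered z = begin-strict
    product (λ e → factor z e (proj₁ chosen e))      ≡⟨ sym (*-identityˡ _) ⟩
    1 * product (λ e → factor z e (proj₁ chosen e))  ≤⟨ term≤sum (λ z → 1 * product (λ e → factor z e (proj₁ chosen e))) z ⟩
    _                                                ≤⟨ proj₂ chosen ⟩
    2 ^ (m * m) * ∑[ z < N * N ] 1                   ≡⟨ cong (2 ^ (m * m) *_) (trans (sum-const (N * N) 1) (*-identityʳ _)) ⟩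
    2 ^ (m * m) * (N * N)                            <⟨ large ⟩
    L ^ (h * h)                                      ∎
    where open ≤-Reasoning

  -- In the application `a i` and `b j` are the neighbourhoods of the terminals of one fixed index,
  -- and `ℓ` gives the label of a vertex; `served` says that each demand between them crosses an
  -- edge between labels.
  module _ {n} (a b : Fin m → Fin n → Bool) (ℓ : Fin n → Fin k)
    (served : ∀ i j → ∃₂ λ u v → a i u ≡ true × b j v ≡ true × ℓ u ⊕ shift i j ≡ ℓ v) where

    light : (Fin m → Fin n → Bool) → Fin m → Bool
    light c i = count (c i) ≤ᵇ d

    -- A heavy group has more than `d` neighbours and gets an arbitrary list, about which nothing is
    -- claimed; only the lists of light groups matter.
    listing : ∀ (c : Fin m → Fin n → Bool) i → Σ (Fin d → Fin k) λ A →
              light c i ≡ true → ∀ u → c i u ≡ true → ∃ λ q → A q ≡ ℓ u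
    listing c i with light c i in eq
    ... | true  = let A , hits = enumerate (c i) ℓ (0 mod k) d (≤ᵇ⇒≤ _ _ (subst T (sym eq) _)) in A , λ _ → hits
    ... | false = (λ _ → 0 mod k) , λ ()

    A B : Fin m → Fin d → Fin k
    A i = proj₁ (listing a i)
    B j = proj₁ (listing b j)

    code : Fin (N * N)
    code = combine (encode A) (encode B)

    bothLight : Fin (m * m) → Bool
    bothLight e = light a (proj₁ (remQuot {m} m e)) ∧ light b (proj₂ (remQuot {m} m e))

    -- The two labels through which the pair is served occur in the lists of their groups, and this
    -- one match already adds `L` to the factor.
    light-pair : ∀ i j → light a i ≡ true → light b j ≡ true →
                 L ≤ factorAt (encode A , encode B) (i , j) (shift i j)
    light-pair i j la lb with served i j
    ... | u , v , au , bv , e with proj₂ (listing a i) la u au | proj₂ (listing b j) lb v bv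
    ... | p , Ap | q , Bq = begin
      L                                                                        ≡⟨ sym (*-identityʳ L) ⟩
      L * 1                                                                    ≤⟨ *-monoʳ-≤ L (1≤matches _ _ (shift i j) p q matched) ⟩
      L * matches (decode (encode A) i) (decode (encode B) j) (shift i j)      ≤⟨ n≤1+n _ ⟩
      1 + L * matches (decode (encode A) i) (decode (encode B) j) (shift i j)  ∎
      where
      open ≤-Reasoning
      matched : decode (encode A) i p ⊕ shift i j ≡ decode (encode B) j q
      matched = trans (cong (_⊕ shift i j) (trans (decode-encode A i p) Ap))
        (trans e (sym (trans (decode-encode B j q) Bq)))

    light-factor : ∀ e → bothLight e ≡ true → L ≤ factor code e (proj₁ chosen e)
    light-factor e both = subst₂ (λ z s → L ≤ factorAt z (remQuot m e) s)
      (sym (remQuot-combine {N} {N} (encode A) (encode B))) (cong (proj₁ chosen) (combine-remQuot {m} m e))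
      (light-pair _ _ (∧-conicalˡ _ _ both) (∧-conicalʳ _ _ both))

    many-pairs : count bothLight ≡ count (light a) * count (light b)
    many-pairs = begin
      count bothLight
        ≡⟨ sum-combine m (𝟙 ∘ bothLight) ⟩
      ∑[ i < m ] ∑[ j < m ] 𝟙 (bothLight (combine i j))
        ≡⟨ sum-cong-≗ (λ i → trans (sum-cong-≗ (λ j → trans (cong 𝟙 (both i j)) (𝟙-∧ (light a i) (light b j))))
             (sym (*-distribˡ-sum (𝟙 (light a i)) (𝟙 ∘ light b)))) ⟩
      ∑[ i < m ] (𝟙 (light a i) * count (light b))
        ≡⟨ sym (*-distribʳ-sum (count (light b)) (𝟙 ∘ light a)) ⟩
      count (light a) * count (light b) ∎
      where
      open ≡-Reasoning
      both : ∀ i j → bothLight (combine i j) ≡ light a i ∧ light b j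
      both i j = cong (λ ij → light a (proj₁ ij) ∧ light b (proj₂ ij)) (remQuot-combine {m} {m} i j)
      𝟙-∧ : ∀ x y → 𝟙 (x ∧ y) ≡ 𝟙 x * 𝟙 y
      𝟙-∧ true  y = sym (*-identityˡ (𝟙 y))
      𝟙-∧ false y = refl

    -- If one side has fewer than `h` light groups, Markov's inequality gives the bound on that side
    -- alone. Otherwise there are at least `h * h` pairs of light groups, and the product for their
    -- code reaches `L ^ (h * h)`, which the shifts rule out.
    cost≥ : h * d ≤ ∑[ i < m ] count (a i) + ∑[ j < m ] count (b j)
    cost≥ with <-≤-connex (count (light a)) h | <-≤-connex (count (light b)) h
    ... | inj₁ few | _        = ≤-trans (markov h d _ few) (m≤m+n _ _)
    ... | inj₂ _   | inj₁ few = ≤-trans (markov h d _ few) (m≤n+m _ _)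
    ... | inj₂ la  | inj₂ lb  = ⊥-elim (<⇒≱ (few-covered code) (begin
      L ^ (h * h)                                     ≤⟨ ^-monoʳ-≤ L (*-mono-≤ la lb) ⟩
      L ^ (count (light a) * count (light b))         ≡⟨ cong (L ^_) (sym many-pairs) ⟩
      L ^ count bothLight                             ≤⟨ ^count≤product L bothLight _ (λ e → s≤s z≤n) light-factor ⟩
      product (λ e → factor code e (proj₁ chosen e))  ∎))
      where open ≤-Reasoning

-- The instance: hub, terminals, labels and safe sets.

∨-true : ∀ x {y} → x ∨ y ≡ true → x ≡ true ⊎ y ≡ true
∨-true true  e = inj₁ refl
∨-true false e = inj₂ e

module Construction (m k : ℕ) .{{_ : NonZero k}} (s : Fin m → Fin m → Fin k) where

  -- The vertices are numbered in the order of the constructors, so isEdge counts each edge at the end where up starts.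
  data Node : Set where
    hub                        : Node
    aTerm bTerm aLabel bLabel  : Fin m → Fin k → Node

  n : ℕ
  n = suc (4 * (m * k))

  node : Fin 4 → Fin m → Fin k → Node
  node 0F = aTerm
  node 1F = bTerm
  node 2F = aLabel
  node 3F = bLabel

  nonHub : Node → Bool
  nonHub hub = false
  nonHub _   = true

  inA inB : Fin m → Node → Bool
  inA i (aLabel i′ _) = ⌊ i ≟ᶠ i′ ⌋
  inA i _             = false
  inB j (bLabel j′ _) = ⌊ j ≟ᶠ j′ ⌋
  inB j _             = false

  shifted : Fin m → Fin k → Node → Bool
  shifted i x (bLabel j y) = ⌊ x ⊕ s i j ≟ᶠ y ⌋
  shifted i x _            = false

  up : Node → Node → Bool
  up hub          = nonHub
  up (aTerm i _)  = inA i
  up (bTerm j _)  = inB j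
  up (aLabel i x) = shifted i x
  up (bLabel _ _) = λ _ → false

  inA⁻ : ∀ {i} y → inA i y ≡ true → ∃ λ x → y ≡ aLabel i x
  inA⁻ (aLabel i′ x) e with refl ← isYes-true e = x , refl

  inB⁻ : ∀ {j} y → inB j y ≡ true → ∃ λ x → y ≡ bLabel j x
  inB⁻ (bLabel j′ x) e with refl ← isYes-true e = x , refl

  shifted⁻ : ∀ {i x} y → shifted i x y ≡ true → ∃ λ j → y ≡ bLabel j (x ⊕ s i j)
  shifted⁻ (bLabel j y) e with refl ← isYes-true e = j , refl

  abstract

    decode : Fin 4 × Fin (m * k) → Node
    decode (b , w) = uncurry (node b) (remQuot {m} k w)

    toNode : Fin n → Node
    toNode zero    = hub
    toNode (suc v) = decode (remQuot {4} (m * k) v)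

    place : Fin 4 → Fin m → Fin k → Fin n
    place b i x = suc (combine {4} b (combine i x))

    fromNode : Node → Fin n
    fromNode hub          = zero
    fromNode (aTerm i r)  = place 0F i r
    fromNode (bTerm j r)  = place 1F j r
    fromNode (aLabel i x) = place 2F i x
    fromNode (bLabel j y) = place 3F j y

    toNode-place : ∀ b i x → toNode (place b i x) ≡ node b i x
    toNode-place b i x = trans (cong decode (remQuot-combine {4} b (combine i x)))
      (cong (uncurry (node b)) (remQuot-combine i x))

    toNode-fromNode : ∀ x → toNode (fromNode x) ≡ x
    toNode-fromNode hub          = refl
    toNode-fromNode (aTerm i r)  = toNode-place 0F i r
    toNode-fromNode (bTerm j r)  = toNode-place 1F j r
    toNode-fromNode (aLabel i x) = toNode-place 2F i x
    toNode-fromNode (bLabel j y) = toNode-place 3F j y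

    fromNode-node : ∀ b i x → fromNode (node b i x) ≡ place b i x
    fromNode-node 0F i x = refl
    fromNode-node 1F i x = refl
    fromNode-node 2F i x = refl
    fromNode-node 3F i x = refl

    fromNode-toNode : ∀ v → fromNode (toNode v) ≡ v
    fromNode-toNode zero    = refl
    fromNode-toNode (suc v) = trans
      (fromNode-node (proj₁ (remQuot {4} (m * k) v)) _ _)
      (cong suc (trans (cong (combine {4} (proj₁ (remQuot {4} (m * k) v))) (combine-remQuot {m} k _))
                       (combine-remQuot {4} (m * k) v)))

    fromNode-hub : fromNode hub ≡ zero
    fromNode-hub = refl

    -- The hub has number zero, every other arc leads from one block to a later block, and `combine`
    -- is monotone in the block.
    up-< : ∀ x y → up x y ≡ true → toℕ (fromNode x) < toℕ (fromNode y)
    up-< hub (aTerm _ _)  _ = s≤s z≤n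
    up-< hub (bTerm _ _)  _ = s≤s z≤n
    up-< hub (aLabel _ _) _ = s≤s z≤n
    up-< hub (bLabel _ _) _ = s≤s z≤n
    up-< (aTerm i r)  y e with _ , refl ← inA⁻ y e     = s≤s (combine-monoˡ-< {4} {m * k} {i = 0F} {2F} _ _ (s≤s z≤n))
    up-< (bTerm j r)  y e with _ , refl ← inB⁻ y e     = s≤s (combine-monoˡ-< {4} {m * k} {i = 1F} {3F} _ _ (s≤s (s≤s z≤n)))
    up-< (aLabel i x) y e with _ , refl ← shifted⁻ y e = s≤s (combine-monoˡ-< {4} {m * k} {i = 2F} {3F} _ _ (s≤s (s≤s (s≤s z≤n))))

    -- The hub and both label blocks are dropped. The terminals are regrouped by their index `r`,
    -- because the lower bound is proved for each index separately.
    sum-terms : ∀ (f : Fin n → ℕ) →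
      ∑[ r < k ] (∑[ i < m ] f (fromNode (aTerm i r)) + ∑[ j < m ] f (fromNode (bTerm j r))) ≤ sum f
    sum-terms f = begin
      ∑[ r < k ] (∑[ i < m ] f (place 0F i r) + ∑[ j < m ] f (place 1F j r))
        ≡⟨ ∑-distrib-+ (λ r → ∑[ i < m ] f (place 0F i r)) (λ r → ∑[ j < m ] f (place 1F j r)) ⟩
      ∑[ r < k ] ∑[ i < m ] f (place 0F i r) + ∑[ r < k ] ∑[ j < m ] f (place 1F j r)
        ≡⟨ cong₂ _+_ (block 0F) (block 1F) ⟩
      β 0F + β 1F                          ≤⟨ +-monoʳ-≤ (β 0F) (m≤m+n (β 1F) _) ⟩
      β 0F + (β 1F + (β 2F + (β 3F + 0)))  ≡⟨ sym (sum-combine 4 {m * k} (f ∘ suc)) ⟩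
      ∑[ v < 4 * (m * k) ] f (suc v)       ≤⟨ m≤n+m _ (f zero) ⟩
      sum f                                ∎
      where
      open ≤-Reasoning
      β : Fin 4 → ℕ
      β b = ∑[ w < m * k ] f (suc (combine {4} b w))
      block : ∀ b → ∑[ r < k ] ∑[ i < m ] f (place b i r) ≡ β b
      block b = trans (∑-comm (λ r i → f (place b i r)))
        (sym (sum-combine m {k} (λ w → f (suc (combine {4} b w)))))

  toNode-≡ : ∀ {v x} → toNode v ≡ x → v ≡ fromNode x
  toNode-≡ {v} e = trans (sym (fromNode-toNode v)) (cong fromNode e)

  toNode-injective : ∀ {v w} → toNode v ≡ toNode w → v ≡ w
  toNode-injective {w = w} e = trans (toNode-≡ e) (fromNode-toNode w)

  adj : Node → Node → Bool
  adj x y = up x y ∨ up y x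

  -- `nothing` marks an unrestricted pair, whose safe set is the whole vertex set. Restrictions are
  -- imposed only in the order from left terminal to right terminal.
  demand : Node → Node → Maybe (Fin m × Fin m)
  demandAt : Fin m → Fin k → Node → Maybe (Fin m × Fin m)
  demand (aTerm i r) = demandAt i r
  demand hub          _ = nothing
  demand (bTerm _ _)  _ = nothing
  demand (aLabel _ _) _ = nothing
  demand (bLabel _ _) _ = nothing
  demandAt i r (bTerm j r′) = if ⌊ r ≟ᶠ r′ ⌋ then just (i , j) else nothing
  demandAt i r _            = nothing

  demand⁺ : ∀ i j r → demand (aTerm i r) (bTerm j r) ≡ just (i , j)
  demand⁺ i j r rewrite isYes-refl {x = r} refl = refl

  demand⁻ : ∀ x y {i j} → demand x y ≡ just (i , j) → ∃ λ r → x ≡ aTerm i r × y ≡ bTerm j r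
  demand⁻ (aTerm i r) (bTerm j r′) e with r ≟ᶠ r′
  demand⁻ (aTerm i r) (bTerm j r)  refl | yes refl = r , refl , refl

  member : Fin n → Fin n → Fin n → Bool
  member u v w = maybe′
    (λ (i , j) → ⌊ w ≟ᶠ u ⌋ ∨ ⌊ w ≟ᶠ v ⌋ ∨ inA i (toNode w) ∨ inB j (toNode w))
    true (demand (toNode u) (toNode v))

  safe : Fin n → Fin n → Subset n
  safe u v = Vec.tabulate (member u v)

  ∈-safe⁺ : ∀ {u v w} → member u v w ≡ true → w ∈ safe u v
  ∈-safe⁺ {u} {v} {w} e = lookup⇒[]= w (safe u v) (trans (lookup∘tabulate (member u v) w) e)

  ∈-safe⁻ : ∀ {u v w} → w ∈ safe u v → member u v w ≡ true
  ∈-safe⁻ {u} {v} {w} w∈ = trans (sym (lookup∘tabulate (member u v) w)) ([]=⇒lookup w∈)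

  member-demand : ∀ {i j r u v} w → toNode u ≡ aTerm i r → toNode v ≡ bTerm j r →
                  member u v w ≡ ⌊ w ≟ᶠ u ⌋ ∨ ⌊ w ≟ᶠ v ⌋ ∨ inA i (toNode w) ∨ inB j (toNode w)
  member-demand {i} {j} {r} {u} {v} w u≡ v≡ = cong (maybe′ _ true) (trans (cong₂ demand u≡ v≡) (demand⁺ i j r))

  member-fst : ∀ u v → member u v u ≡ true
  member-fst u v with demand (toNode u) (toNode v)
  ... | nothing = refl
  ... | just _  rewrite isYes-refl {x = u} refl = refl

  member-snd : ∀ u v → member u v v ≡ true
  member-snd u v with demand (toNode u) (toNode v)
  ... | nothing = refl
  ... | just _  rewrite isYes-refl {x = v} refl = ∨-zeroʳ _

  I : Instance
  I = record
    { n     = n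
    ; G     = λ v w → adj (toNode v) (toNode w)
    ; G-sym = λ v w → ∨-comm (up (toNode v) (toNode w)) _
    ; G-irr = λ v → irr (toNode v)
    ; S     = safe
    ; S-fst = λ u v → ∈-safe⁺ (member-fst u v)
    ; S-snd = λ u v → ∈-safe⁺ (member-snd u v)
    }
    where
    irr : ∀ x → adj x x ≡ false
    irr hub          = refl
    irr (aTerm _ _)  = refl
    irr (bTerm _ _)  = refl
    irr (aLabel _ _) = refl
    irr (bLabel _ _) = refl

  open Instance I using (G)

  edge-up : ∀ v w → isEdge G v w ≡ true → up (toNode v) (toNode w) ≡ true
  edge-up v w e with ∨-true (up (toNode v) (toNode w)) (∧-conicalˡ _ _ e)
  ... | inj₁ v↑w = v↑w
  ... | inj₂ w↑v = ⊥-elim (<-asym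
    (subst₂ (λ v w → toℕ w < toℕ v) (fromNode-toNode v) (fromNode-toNode w) (up-< _ _ w↑v))
    (<ᵇ⇒< _ _ (Equivalence.from T-≡ (∧-conicalʳ (G v w) _ e))))

  up-edge : ∀ (H : Adj n) v w → H v w ≡ true → up (toNode v) (toNode w) ≡ true → isEdge H v w ≡ true
  up-edge H v w e v↑w rewrite e = Equivalence.to T-≡ (<⇒<ᵇ
    (subst₂ (λ v w → toℕ v < toℕ w) (fromNode-toNode v) (fromNode-toNode w) (up-< _ _ v↑w)))

  toNode-zero : toNode zero ≡ hub
  toNode-zero = trans (cong toNode (sym fromNode-hub)) (toNode-fromNode hub)

  toNode-suc : ∀ v → toNode (suc v) ≢ hub
  toNode-suc v e with () ← trans (toNode-≡ e) fromNode-hub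

  label : Node → Fin k
  label (aLabel _ x) = x
  label (bLabel _ y) = y
  label _            = 0 mod k

  -- Safe paths in an integral solution.

  module LowerBound (H : Adj n) (H⊆G : IsSubgraph I H) (conn : SafelyConnected I H) where

    -- Only edges towards later vertices count, so degrees of distinct vertices add up without
    -- counting an edge twice.
    degree : Fin n → ℕ
    degree v = count (isEdge H v)

    edgeCount≥ : ∑[ r < k ] (∑[ i < m ] degree (fromNode (aTerm i r)) + ∑[ j < m ] degree (fromNode (bTerm j r)))
                 ≤ edgeCount H
    edgeCount≥ = ≤-trans (sum-terms degree) (≤-reflexive (sym (trans
      (sumFinℕ≡sum (λ v → sumFinℕ (𝟙 ∘ isEdge H v))) (sum-cong-≗ (λ v → sumFinℕ≡sum (𝟙 ∘ isEdge H v))))))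

    adjacent : ∀ {v w x y} → H v w ≡ true → toNode v ≡ x → toNode w ≡ y → adj x y ≡ true
    adjacent {v} {w} e refl refl = proj₂ H⊆G v w e

    module _ {i j r u v} (u≡ : toNode u ≡ aTerm i r) (v≡ : toNode v ≡ bTerm j r) where

      data Kind (w : Fin n) : Set where
        start  : w ≡ u → Kind w
        finish : w ≡ v → Kind w
        left   : ∀ x → toNode w ≡ aLabel i x → Kind w
        right  : ∀ y → toNode w ≡ bLabel j y → Kind w

      kind : ∀ {w} → w ∈ safe u v → Kind w
      kind {w} w∈ with ∨-true ⌊ w ≟ᶠ u ⌋ (trans (sym (member-demand w u≡ v≡)) (∈-safe⁻ {u} {v} {w} w∈))
      ... | inj₁ e = start (isYes-true e)
      ... | inj₂ e with ∨-true ⌊ w ≟ᶠ v ⌋ e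
      ... | inj₁ e = finish (isYes-true e)
      ... | inj₂ e with ∨-true (inA i (toNode w)) e
      ... | inj₁ e = let x , eq = inA⁻ _ e in left x eq
      ... | inj₂ e = let y , eq = inB⁻ _ e in right y eq

      Served : Set
      Served = ∃₂ λ w w′ → isEdge H u w ≡ true × isEdge H v w′ ≡ true
               × label (toNode w) ⊕ s i j ≡ label (toNode w′)

      -- A safe path can leave `u` only to a left label of group `i`, and proceed from there only to
      -- the right label given by the shift. The next vertex must be `v`, as the sole alternative is
      -- to return to the left label just visited.
      serve : ∀ P → IsPath H (safe u v) u v P → Served
      serve (_ ∷ []) (refl , refl , _) with () ← trans (sym u≡) v≡
      serve (_ ∷ w₁ ∷ P) (refl , lst , (u≢w₁ ∷ u∉) ∷ uniq , (e₁ , es) , _ ∷ w₁∈ ∷ P∈) with kind w₁∈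
      ... | start refl = ⊥-elim (u≢w₁ refl)
      ... | finish refl with () ← adjacent e₁ u≡ v≡
      ... | right _ w₁≡ with () ← adjacent e₁ u≡ w₁≡
      ... | left x w₁≡ = second P lst u∉ uniq es P∈
        where
        edge₁ : isEdge H u w₁ ≡ true
        edge₁ = up-edge H u w₁ e₁ (trans (cong₂ up u≡ w₁≡) (isYes-refl refl))
        third : ∀ w₂ P {y} → toNode w₂ ≡ bLabel j y → x ⊕ s i j ≡ y → last (w₂ ∷ P) ≡ just v →
                All (λ w → w₁ ≢ w) P → Consec H (w₂ ∷ P) → All (_∈ safe u v) P → Served
        third w₂ [] w₂≡ _ refl _ _ _ with () ← trans (sym w₂≡) v≡
        third w₂ (w₃ ∷ P) {y} w₂≡ match lst (w₁≢w₃ ∷ _) (e₃ , _) (w₃∈ ∷ _) with kind w₃∈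
        ... | start refl with () ← adjacent e₃ w₂≡ u≡
        ... | right _ w₃≡ with () ← adjacent e₃ w₂≡ w₃≡
        -- Translation by the shift is injective, so this left label is the one already visited,
        -- against simplicity of the path.
        ... | left x′ w₃≡ = ⊥-elim (w₁≢w₃ (toNode-injective (trans w₁≡ (trans (cong (aLabel i)
          (⊕-cancelʳ (s i j) (trans match (sym (isYes-true (adjacent e₃ w₂≡ w₃≡)))))) (sym w₃≡)))))
        -- The last edge is turned round: `isEdge` records it at the terminal, which precedes the
        -- label.
        ... | finish refl = w₁ , w₂ , edge₁ ,
          up-edge H v w₂ (trans (proj₁ H⊆G v w₂) e₃) (trans (cong₂ up v≡ w₂≡) (isYes-refl refl)) ,
          trans (cong (λ z → label z ⊕ s i j) w₁≡) (trans match (cong label (sym w₂≡)))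
        second : ∀ P → last (w₁ ∷ P) ≡ just v → All (λ w → u ≢ w) P → Unique (w₁ ∷ P) →
                 Consec H (w₁ ∷ P) → All (_∈ safe u v) P → Served
        second [] refl _ _ _ _ with () ← trans (sym w₁≡) v≡
        second (w₂ ∷ P) lst (u≢w₂ ∷ _) ((_ ∷ w₁∉) ∷ _) (e₂ , es) (w₂∈ ∷ P∈) with kind w₂∈
        ... | start refl = ⊥-elim (u≢w₂ refl)
        ... | finish refl with () ← adjacent e₂ w₁≡ v≡
        ... | left _ w₂≡ with () ← adjacent e₂ w₁≡ w₂≡
        ... | right y w₂≡ = third w₂ P w₂≡ (isYes-true (trans (sym (∨-identityʳ _)) (adjacent e₂ w₁≡ w₂≡))) lst w₁∉ es P∈

      served : Served
      served = let P , isPath = conn u v in serve P isPath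

-- Natural numbers and finite sums in the rationals.

toℚᵘ-ℕ→ℚ : ∀ a → toℚᵘ (ℕ→ℚ a) ℚᵘ.≃ ℚᵘ.mkℚᵘ (ℤ.+ a) 0
toℚᵘ-ℕ→ℚ a = ℚ.toℚᵘ-fromℚᵘ (ℚᵘ.mkℚᵘ (ℤ.+ a) 0)

ℕ→ℚ-+ : ∀ a b → ℕ→ℚ (a + b) ≡ ℕ→ℚ a +ℚ ℕ→ℚ b
ℕ→ℚ-+ a b = ℚ.toℚᵘ-injective (begin
  toℚᵘ (ℕ→ℚ (a + b))                        ≈⟨ toℚᵘ-ℕ→ℚ (a + b) ⟩
  ℚᵘ.mkℚᵘ (ℤ.+ (a + b)) 0                   ≈⟨ ℚᵘ.*≡* (cong (ℤ._* ℤ.+ 1) (sym (cong₂ ℤ._+_ (ℤ.*-identityʳ (ℤ.+ a)) (ℤ.*-identityʳ (ℤ.+ b))))) ⟩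
  ℚᵘ.mkℚᵘ (ℤ.+ a) 0 ℚᵘ.+ ℚᵘ.mkℚᵘ (ℤ.+ b) 0  ≈⟨ ℚᵘ.≃-sym (ℚᵘ.+-cong (toℚᵘ-ℕ→ℚ a) (toℚᵘ-ℕ→ℚ b)) ⟩
  toℚᵘ (ℕ→ℚ a) ℚᵘ.+ toℚᵘ (ℕ→ℚ b)            ≈⟨ ℚᵘ.≃-sym (ℚ.toℚᵘ-homo-+ (ℕ→ℚ a) (ℕ→ℚ b)) ⟩
  toℚᵘ (ℕ→ℚ a +ℚ ℕ→ℚ b)                     ∎)
  where open ℚᵘ.≃-Reasoning

ℕ→ℚ-* : ∀ a b → ℕ→ℚ (a * b) ≡ ℕ→ℚ a *ℚ ℕ→ℚ b
ℕ→ℚ-* a b = ℚ.toℚᵘ-injective (begin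
  toℚᵘ (ℕ→ℚ (a * b))                        ≈⟨ toℚᵘ-ℕ→ℚ (a * b) ⟩
  ℚᵘ.mkℚᵘ (ℤ.+ (a * b)) 0                   ≈⟨ ℚᵘ.*≡* (cong (ℤ._* ℤ.+ 1) (ℤ.pos-* a b)) ⟩
  ℚᵘ.mkℚᵘ (ℤ.+ a) 0 ℚᵘ.* ℚᵘ.mkℚᵘ (ℤ.+ b) 0  ≈⟨ ℚᵘ.≃-sym (ℚᵘ.*-cong (toℚᵘ-ℕ→ℚ a) (toℚᵘ-ℕ→ℚ b)) ⟩
  toℚᵘ (ℕ→ℚ a) ℚᵘ.* toℚᵘ (ℕ→ℚ b)            ≈⟨ ℚᵘ.≃-sym (ℚ.toℚᵘ-homo-* (ℕ→ℚ a) (ℕ→ℚ b)) ⟩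
  toℚᵘ (ℕ→ℚ a *ℚ ℕ→ℚ b)                     ∎)
  where open ℚᵘ.≃-Reasoning

ℕ→ℚ-nonNeg : ∀ a → NonNegative (ℕ→ℚ a)
ℕ→ℚ-nonNeg a = ℚ.normalize-nonNeg a 1

ℕ→ℚ-pos : ∀ a .{{_ : NonZero a}} → Positive (ℕ→ℚ a)
ℕ→ℚ-pos a = ℚ.normalize-pos a 1

ℕ→ℚ-mono : ∀ {a b} → a ≤ b → ℕ→ℚ a ≤ℚ ℕ→ℚ b
ℕ→ℚ-mono {a} {b} a≤b = begin
  ℕ→ℚ a                 ≡⟨ sym (ℚ.+-identityʳ _) ⟩
  ℕ→ℚ a +ℚ 0ℚ           ≤⟨ ℚ.+-monoʳ-≤ (ℕ→ℚ a) (ℚ.nonNegative⁻¹ (ℕ→ℚ (b ∸ a)) {{ℕ→ℚ-nonNeg (b ∸ a)}}) ⟩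
  ℕ→ℚ a +ℚ ℕ→ℚ (b ∸ a)  ≡⟨ sym (ℕ→ℚ-+ a (b ∸ a)) ⟩
  ℕ→ℚ (a + (b ∸ a))     ≡⟨ cong ℕ→ℚ (m+[n∸m]≡n a≤b) ⟩
  ℕ→ℚ b                 ∎
  where open ℚ.≤-Reasoning

reciprocal : (a : ℕ) .{{_ : NonZero a}} → ℚ
reciprocal a = (1/ ℕ→ℚ a) {{ℚ.pos⇒nonZero (ℕ→ℚ a) {{ℕ→ℚ-pos a}}}}

reciprocal-pos : ∀ a .{{_ : NonZero a}} → Positive (reciprocal a)
reciprocal-pos a = ℚ.1/pos⇒pos (ℕ→ℚ a) {{ℕ→ℚ-pos a}}

*-reciprocal : ∀ a .{{_ : NonZero a}} → ℕ→ℚ a *ℚ reciprocal a ≡ 1ℚ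
*-reciprocal a = ℚ.*-inverseʳ (ℕ→ℚ a) {{ℚ.pos⇒nonZero (ℕ→ℚ a) {{ℕ→ℚ-pos a}}}}

sumFin-indicator : ∀ {n} (p : Fin n → Bool) q → sumFin (λ i → if p i then q else 0ℚ) ≡ ℕ→ℚ (count p) *ℚ q
sumFin-indicator {zero}  p q = sym (ℚ.*-zeroˡ q)
sumFin-indicator {suc n} p q with p zero
... | false = trans (ℚ.+-identityˡ _) (sumFin-indicator (p ∘ suc) q)
... | true  = begin
  q +ℚ sumFin (λ i → if p (suc i) then q else 0ℚ)  ≡⟨ cong₂ _+ℚ_ (sym (ℚ.*-identityˡ q)) (sumFin-indicator (p ∘ suc) q) ⟩
  1ℚ *ℚ q +ℚ ℕ→ℚ (count (p ∘ suc)) *ℚ q            ≡⟨ sym (ℚ.*-distribʳ-+ q 1ℚ (ℕ→ℚ (count (p ∘ suc)))) ⟩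
  (1ℚ +ℚ ℕ→ℚ (count (p ∘ suc))) *ℚ q               ≡⟨ cong (_*ℚ q) (sym (ℕ→ℚ-+ 1 (count (p ∘ suc)))) ⟩
  ℕ→ℚ (suc (count (p ∘ suc))) *ℚ q                 ∎
  where open ≡-Reasoning

sumFin-≤ : ∀ {n} {f : Fin n → ℚ} {g : Fin n → ℕ} → (∀ i → f i ≤ℚ ℕ→ℚ (g i)) → sumFin f ≤ℚ ℕ→ℚ (sum g)
sumFin-≤ {zero}          f≤g = ℚ.≤-refl
sumFin-≤ {suc n} {g = g} f≤g = ℚ.≤-trans (ℚ.+-mono-≤ (f≤g zero) (sumFin-≤ (f≤g ∘ suc)))
  (ℚ.≤-reflexive (sym (ℕ→ℚ-+ (g zero) (sum (g ∘ suc)))))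

sumFin-nonNeg : ∀ {n} (f : Fin n → ℚ) → (∀ i → 0ℚ ≤ℚ f i) → 0ℚ ≤ℚ sumFin f
sumFin-nonNeg {zero}  f 0≤f = ℚ.≤-refl
sumFin-nonNeg {suc n} f 0≤f = ℚ.+-mono-≤ (0≤f zero) (sumFin-nonNeg (f ∘ suc) (0≤f ∘ suc))

sumℚ-tabulate : ∀ {n} (f : Fin n → ℚ) → sumℚ (tabulate f) ≡ sumFin f
sumℚ-tabulate {zero}  f = refl
sumℚ-tabulate {suc n} f = cong (λ x → f zero +ℚ x) (sumℚ-tabulate (f ∘ suc))

-- The fractional solution and its value.

usesEdge⁻ : ∀ {n} (i j x y : Fin n) r → usesEdge i j (x ∷ y ∷ r) ≡ true →
            (x ≡ i × y ≡ j) ⊎ (x ≡ j × y ≡ i) ⊎ usesEdge i j (y ∷ r) ≡ true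
usesEdge⁻ i j x y r e with ∨-true (⌊ x ≟ᶠ i ⌋ ∧ ⌊ y ≟ᶠ j ⌋) e
... | inj₁ e = inj₁ (isYes-true (∧-conicalˡ _ _ e) , isYes-true (∧-conicalʳ ⌊ x ≟ᶠ i ⌋ _ e))
... | inj₂ e with ∨-true (⌊ x ≟ᶠ j ⌋ ∧ ⌊ y ≟ᶠ i ⌋) e
... | inj₁ e = inj₂ (inj₁ (isYes-true (∧-conicalˡ _ _ e) , isYes-true (∧-conicalʳ ⌊ x ≟ᶠ j ⌋ _ e)))
... | inj₂ e = inj₂ (inj₂ e)

module Fractional (m k : ℕ) .{{_ : NonZero k}} (s : Fin m → Fin m → Fin k) where

  open Construction m k s
  open Instance I using (G)

  κ : ℚ
  κ = reciprocal k

  0≤κ : 0ℚ ≤ℚ κ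
  0≤κ = ℚ.nonNegative⁻¹ κ {{ℚ.pos⇒nonNeg κ {{reciprocal-pos k}}}}

  a*κ≤1 : ∀ {a} → a ≤ k → ℕ→ℚ a *ℚ κ ≤ℚ 1ℚ
  a*κ≤1 {a} a≤k = ℚ.≤-trans
    (ℚ.*-monoʳ-≤-nonNeg κ {{ℚ.pos⇒nonNeg κ {{reciprocal-pos k}}}} (ℕ→ℚ-mono a≤k)) (ℚ.≤-reflexive (*-reciprocal k))

  κ≤1 : κ ≤ℚ 1ℚ
  κ≤1 = ℚ.≤-trans (ℚ.≤-reflexive (sym (ℚ.*-identityˡ κ))) (a*κ≤1 {1} (>-nonZero⁻¹ k))

  cost : Node → ℚ
  cost x = if nonHub x then κ else 1ℚ

  κ≤cost : ∀ x → κ ≤ℚ cost x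
  κ≤cost x with nonHub x
  ... | true  = ℚ.≤-refl
  ... | false = κ≤1

  cost≤1 : ∀ x → cost x ≤ℚ 1ℚ
  cost≤1 x with nonHub x
  ... | true  = κ≤1
  ... | false = ℚ.≤-refl

  -- An edge is stored at its earlier end, and the hub comes first of all vertices. Thus edges at
  -- the hub get capacity 1 and all other edges get `1 / k`.
  capacity : Fin n → Fin n → ℚ
  capacity v _ = cost (toNode v)

  record Feasible (u v : Fin n) (fl : FlowList I) : Set where
    field
      distinct : Unique (map proj₁ fl)
      paths    : All (λ pw → IsPath G (safe u v) u v (proj₁ pw) × (0ℚ ≤ℚ proj₂ pw) × (proj₂ pw ≤ℚ 1ℚ)) fl
      unit     : 1ℚ ≤ℚ sumℚ (map proj₂ fl)
      fits     : ∀ i j → isEdge G i j ≡ true → load I i j fl ≤ℚ capacity i j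

  nonHub-suc : ∀ v → nonHub (toNode (suc v)) ≡ true
  nonHub-suc v with toNode (suc v) in e
  ... | hub        = ⊥-elim (toNode-suc v e)
  ... | aTerm _ _  = refl
  ... | bTerm _ _  = refl
  ... | aLabel _ _ = refl
  ... | bLabel _ _ = refl

  ¬up-hub : ∀ x → up x hub ≢ true
  ¬up-hub hub          ()
  ¬up-hub (aTerm _ _)  ()
  ¬up-hub (bTerm _ _)  ()
  ¬up-hub (aLabel _ _) ()
  ¬up-hub (bLabel _ _) ()

  hub-edge : ∀ v → G zero (suc v) ≡ true
  hub-edge v rewrite toNode-zero | nonHub-suc v = refl

  edge-hub : ∀ v → G (suc v) zero ≡ true
  edge-hub v = trans (Instance.G-sym I (suc v) zero) (hub-edge v)

  -- Since no `up` arc ends at the hub, an edge at the hub has it as its first end, where the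
  -- capacity is 1.
  alongHub : ∀ {i j} → isEdge G i j ≡ true → i ≡ zero ⊎ j ≡ zero → 1ℚ ≤ℚ capacity i j
  alongHub _ (inj₁ refl) = ℚ.≤-reflexive (sym (cong cost toNode-zero))
  alongHub {i} e (inj₂ refl) = ⊥-elim (¬up-hub (toNode i)
    (subst (λ y → up (toNode i) y ≡ true) toNode-zero (edge-up i zero e)))

  -- One path may carry the whole unit of flow when all its edges touch the hub, because these have
  -- full capacity.
  singlePath : ∀ {u v} P → IsPath G (safe u v) u v P →
               (∀ i j → usesEdge i j P ≡ true → i ≡ zero ⊎ j ≡ zero) → ∃ (Feasible u v)
  singlePath P isPath hubEdges = ((P , 1ℚ) ∷ []) , record
    { distinct = [] ∷ []
    ; paths    = (isPath , ℚ.≤-trans 0≤κ κ≤1 , ℚ.≤-refl) ∷ []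
    ; unit     = ℚ.≤-refl
    ; fits     = fits
    }
    where
    fits : ∀ i j → isEdge G i j ≡ true → load I i j ((P , 1ℚ) ∷ []) ≤ℚ capacity i j
    fits i j e with usesEdge i j P in uses
    ... | true  = alongHub {i} {j} e (hubEdges i j uses)
    ... | false = ℚ.≤-trans 0≤κ (κ≤cost (toNode i))

  viaHub : ∀ u v → demand (toNode u) (toNode v) ≡ nothing → ∃ (Feasible u v)
  viaHub u v none = route u v (λ w → ∈-safe⁺ {u} {v} {w} (cong (maybe′ _ true) none))
    where
    route : ∀ u v → (∀ w → w ∈ safe u v) → ∃ (Feasible u v)
    route zero zero all = singlePath (zero ∷ []) (refl , refl , [] ∷ [] , _ , all zero ∷ []) λ _ _ ()
    route zero (suc v) all = singlePath (zero ∷ suc v ∷ [])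
      (refl , refl , ((λ ()) ∷ []) ∷ [] ∷ [] , (hub-edge v , _) , all zero ∷ all (suc v) ∷ []) uses
      where
      uses : ∀ i j → usesEdge i j (zero ∷ suc v ∷ []) ≡ true → i ≡ zero ⊎ j ≡ zero
      uses i j e with usesEdge⁻ i j zero (suc v) [] e
      ... | inj₁ (refl , _)        = inj₁ refl
      ... | inj₂ (inj₁ (refl , _)) = inj₂ refl
    route (suc u) zero all = singlePath (suc u ∷ zero ∷ [])
      (refl , refl , ((λ ()) ∷ []) ∷ [] ∷ [] , (edge-hub u , _) , all (suc u) ∷ all zero ∷ []) uses
      where
      uses : ∀ i j → usesEdge i j (suc u ∷ zero ∷ []) ≡ true → i ≡ zero ⊎ j ≡ zero
      uses i j e with usesEdge⁻ i j (suc u) zero [] e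
      ... | inj₁ (_ , refl)        = inj₂ refl
      ... | inj₂ (inj₁ (_ , refl)) = inj₁ refl
    route (suc u) (suc v) all with suc u ≟ᶠ suc v
    -- With equal ends a detour through the hub would repeat a vertex, so the path stays put.
    ... | yes refl = singlePath (suc u ∷ []) (refl , refl , [] ∷ [] , _ , all (suc u) ∷ []) λ _ _ ()
    ... | no u≢v   = singlePath (suc u ∷ zero ∷ suc v ∷ [])
      (refl , refl , ((λ ()) ∷ u≢v ∷ []) ∷ ((λ ()) ∷ []) ∷ [] ∷ [] , (edge-hub u , hub-edge v , _) ,
       all (suc u) ∷ all zero ∷ all (suc v) ∷ []) uses
      where
      uses : ∀ i j → usesEdge i j (suc u ∷ zero ∷ suc v ∷ []) ≡ true → i ≡ zero ⊎ j ≡ zero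
      uses i j e with usesEdge⁻ i j (suc u) zero (suc v ∷ []) e
      ... | inj₁ (_ , refl)        = inj₂ refl
      ... | inj₂ (inj₁ (_ , refl)) = inj₁ refl
      ... | inj₂ (inj₂ e) with usesEdge⁻ i j zero (suc v) [] e
      ... | inj₁ (refl , _)        = inj₁ refl
      ... | inj₂ (inj₁ (refl , _)) = inj₂ refl

  -- Each left label `x` gives a path through `x` and its shifted partner, carrying `1 / k`. As the
  -- shift is injective, the `k` paths share no edge, and capacity `1 / k` is enough.
  spread : ∀ {i j r} u v → toNode u ≡ aTerm i r → toNode v ≡ bTerm j r → ∃ (Feasible u v)
  spread {i} {j} {r} u v u≡ v≡ = tabulate (λ x → path x , κ) , record
    { distinct = subst Unique (sym (map-tabulate (λ x → path x , κ) proj₁))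
        (Unique.tabulate⁺ λ e → aLabel-injective (node-≡ (a≡ _) (a≡ _) (∷-injectiveˡ (∷-injectiveʳ e))))
    ; paths    = All.tabulate⁺ λ x → isPath x , 0≤κ , κ≤1
    ; unit     = ℚ.≤-reflexive (sym (trans (cong sumℚ (map-tabulate (λ x → path x , κ) proj₂)) total))
    ; fits     = fits
    }
    where
    a b : Fin k → Fin n
    a x = fromNode (aLabel i x)
    b x = fromNode (bLabel j (x ⊕ s i j))

    a≡ : ∀ x → toNode (a x) ≡ aLabel i x
    a≡ x = toNode-fromNode _

    b≡ : ∀ x → toNode (b x) ≡ bLabel j (x ⊕ s i j)
    b≡ x = toNode-fromNode _

    path : Fin k → List (Fin n)
    path x = u ∷ a x ∷ b x ∷ v ∷ []

    node-≡ : ∀ {w w′ x y} → toNode w ≡ x → toNode w′ ≡ y → w ≡ w′ → x ≡ y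
    node-≡ w≡ w′≡ refl = trans (sym w≡) w′≡

    aLabel-injective : ∀ {x y} → aLabel i x ≡ aLabel i y → x ≡ y
    aLabel-injective refl = refl

    bLabel-injective : ∀ {x y} → bLabel j x ≡ bLabel j y → x ≡ y
    bLabel-injective refl = refl

    node-≢ : ∀ {w w′ x y} → toNode w ≡ x → toNode w′ ≡ y → x ≢ y → w ≢ w′
    node-≢ w≡ w′≡ x≢y w≡w′ = x≢y (node-≡ w≡ w′≡ w≡w′)

    isPath : ∀ x → IsPath G (safe u v) u v (path x)
    isPath x = refl , refl
      , (node-≢ u≡ (a≡ x) (λ ()) ∷ node-≢ u≡ (b≡ x) (λ ()) ∷ node-≢ u≡ v≡ (λ ()) ∷ [])
        ∷ (node-≢ (a≡ x) (b≡ x) (λ ()) ∷ node-≢ (a≡ x) v≡ (λ ()) ∷ [])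
        ∷ (node-≢ (b≡ x) v≡ (λ ()) ∷ []) ∷ [] ∷ []
      , (trans (cong₂ adj u≡ (a≡ x)) (trans (∨-identityʳ _) (isYes-refl refl))
        , trans (cong₂ adj (a≡ x) (b≡ x)) (trans (∨-identityʳ _) (isYes-refl refl))
        , trans (cong₂ adj (b≡ x) v≡) (isYes-refl refl)
        , _)
      , Instance.S-fst I u v ∷ ∈-safe⁺ {u} {v} {a x} a∈ ∷ ∈-safe⁺ {u} {v} {b x} b∈ ∷ Instance.S-snd I u v ∷ []
      where
      a∈ : member u v (a x) ≡ true
      a∈ rewrite member-demand (a x) u≡ v≡ | a≡ x | isYes-refl {x = i} refl =
        trans (cong (⌊ a x ≟ᶠ u ⌋ ∨_) (∨-zeroʳ ⌊ a x ≟ᶠ v ⌋)) (∨-zeroʳ ⌊ a x ≟ᶠ u ⌋)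
      b∈ : member u v (b x) ≡ true
      b∈ rewrite member-demand (b x) u≡ v≡ | b≡ x | isYes-refl {x = j} refl =
        trans (cong (⌊ b x ≟ᶠ u ⌋ ∨_) (∨-zeroʳ ⌊ b x ≟ᶠ v ⌋)) (∨-zeroʳ ⌊ b x ≟ᶠ u ⌋)

    total : sumℚ (tabulate {n = k} (λ _ → κ)) ≡ 1ℚ
    total = trans (sumℚ-tabulate {k} (λ _ → κ)) (trans (sumFin-indicator {k} (λ _ → true) κ)
      (trans (cong (λ c → ℕ→ℚ c *ℚ κ) (trans (sum-const k 1) (*-identityʳ k))) (*-reciprocal k)))

    Carries : Fin n → Fin k → Set
    Carries w x = toNode w ≡ aLabel i x ⊎ toNode w ≡ bLabel j (x ⊕ s i j)

    -- The later end of any edge on a path is one of its two labels, whichever way the edge is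
    -- traversed; that label determines `x`.
    carries : ∀ v₁ v₂ → isEdge G v₁ v₂ ≡ true → ∀ x → usesEdge v₁ v₂ (path x) ≡ true → Carries v₂ x
    carries v₁ v₂ e x uses with edge-up v₁ v₂ e | usesEdge⁻ v₁ v₂ u (a x) (b x ∷ v ∷ []) uses
    ... | v₁↑v₂ | inj₁ (refl , refl) = inj₁ (a≡ x)
    ... | v₁↑v₂ | inj₂ (inj₁ (refl , refl)) with () ← trans (sym (cong₂ up (a≡ x) u≡)) v₁↑v₂
    ... | v₁↑v₂ | inj₂ (inj₂ uses) with usesEdge⁻ v₁ v₂ (a x) (b x) (v ∷ []) uses
    ... | inj₁ (refl , refl) = inj₂ (b≡ x)
    ... | inj₂ (inj₁ (refl , refl)) = inj₁ (a≡ x)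
    ... | inj₂ (inj₂ uses) with usesEdge⁻ v₁ v₂ (b x) v [] uses
    ... | inj₁ (refl , refl) with () ← trans (sym (cong₂ up (b≡ x) v≡)) v₁↑v₂
    carries v₁ v₂ e x uses | v₁↑v₂ | inj₂ (inj₂ _) | inj₂ (inj₂ _) | inj₂ (inj₁ (refl , refl)) = inj₂ (b≡ x)
    carries v₁ v₂ e x uses | v₁↑v₂ | inj₂ (inj₂ _) | inj₂ (inj₂ _) | inj₂ (inj₂ ())

    carries-unique : ∀ {w x y} → Carries w x → Carries w y → x ≡ y
    carries-unique (inj₁ p) (inj₁ q) = aLabel-injective (trans (sym p) q)
    carries-unique (inj₂ p) (inj₂ q) = ⊕-cancelʳ (s i j) (bLabel-injective (trans (sym p) q))
    carries-unique (inj₁ p) (inj₂ q) with () ← trans (sym p) q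
    carries-unique (inj₂ p) (inj₁ q) with () ← trans (sym p) q

    fits : ∀ v₁ v₂ → isEdge G v₁ v₂ ≡ true → load I v₁ v₂ (tabulate (λ x → path x , κ)) ≤ℚ capacity v₁ v₂
    fits v₁ v₂ e = begin
      load I v₁ v₂ (tabulate (λ x → path x , κ))
        ≡⟨ cong sumℚ (map-tabulate (λ x → path x , κ) _) ⟩
      sumℚ (tabulate (λ x → if usesEdge v₁ v₂ (path x) then κ else 0ℚ))
        ≡⟨ sumℚ-tabulate (λ x → if usesEdge v₁ v₂ (path x) then κ else 0ℚ) ⟩
      sumFin (λ x → if usesEdge v₁ v₂ (path x) then κ else 0ℚ)
        ≡⟨ sumFin-indicator (λ x → usesEdge v₁ v₂ (path x)) κ ⟩
      ℕ→ℚ (count (λ x → usesEdge v₁ v₂ (path x))) *ℚ κ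
        ≤⟨ ℚ.*-monoʳ-≤-nonNeg κ {{ℚ.pos⇒nonNeg κ {{reciprocal-pos k}}}} (ℕ→ℚ-mono (count-unique (λ x → usesEdge v₁ v₂ (path x))
             λ x y p q → carries-unique {v₂} (carries v₁ v₂ e x p) (carries v₁ v₂ e y q))) ⟩
      1ℚ *ℚ κ
        ≡⟨ ℚ.*-identityˡ κ ⟩
      κ
        ≤⟨ κ≤cost (toNode v₁) ⟩
      capacity v₁ v₂ ∎
      where open ℚ.≤-Reasoning

  flowFor : ∀ u v → ∃ (Feasible u v)
  flowFor u v with demand (toNode u) (toNode v) in eq
  ... | nothing      = viaHub u v eq
  ... | just (i , j) = let r , u≡ , v≡ = demand⁻ _ _ eq in spread u v u≡ v≡

  flow : Fin n → Fin n → FlowList I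
  flow u v = proj₁ (flowFor u v)

  lpFeasible : LPFeasible I capacity flow
  lpFeasible = (λ i _ _ → ℚ.≤-trans 0≤κ (κ≤cost (toNode i)) , cost≤1 (toNode i))
    , (λ u v → Feasible.distinct (proj₂ (flowFor u v)))
    , (λ u v → Feasible.paths (proj₂ (flowFor u v)))
    , (λ u v → Feasible.unit (proj₂ (flowFor u v)))
    , (λ u v → Feasible.fits (proj₂ (flowFor u v)))

  0≤lpValue : 0ℚ ≤ℚ lpValue I capacity
  0≤lpValue = sumFin-nonNeg _ λ v → sumFin-nonNeg _ λ w → 0≤term v w
    where
    0≤term : ∀ v w → 0ℚ ≤ℚ (if isEdge G v w then capacity v w else 0ℚ)
    0≤term v w with isEdge G v w
    ... | true  = ℚ.≤-trans 0≤κ (κ≤cost (toNode v))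
    ... | false = ℚ.≤-refl

  module _ (m≤k : m ≤ k) where

    -- A terminal has at most one later neighbour per label of its group, a left label at most one
    -- per right group, and a right label none. The bound `m ≤ k` covers the left labels.
    upDegree≤k : ∀ v x → toNode v ≡ x → x ≢ hub → count (isEdge G v) ≤ k
    upDegree≤k v hub          v≡ x≢hub = ⊥-elim (x≢hub refl)
    upDegree≤k v (aTerm i r)  v≡ _ = count-≤-cover (isEdge G v) (fromNode ∘ aLabel i) λ w e →
      let x , w≡ = inA⁻ _ (subst (λ z → up z (toNode w) ≡ true) v≡ (edge-up v w e)) in x , sym (toNode-≡ w≡)
    upDegree≤k v (bTerm j r)  v≡ _ = count-≤-cover (isEdge G v) (fromNode ∘ bLabel j) λ w e →
      let x , w≡ = inB⁻ _ (subst (λ z → up z (toNode w) ≡ true) v≡ (edge-up v w e)) in x , sym (toNode-≡ w≡)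
    upDegree≤k v (aLabel i x) v≡ _ = ≤-trans
      (count-≤-cover (isEdge G v) (λ j → fromNode (bLabel j (x ⊕ s i j))) λ w e →
        let j , w≡ = shifted⁻ _ (subst (λ z → up z (toNode w) ≡ true) v≡ (edge-up v w e)) in j , sym (toNode-≡ w≡))
      m≤k
    upDegree≤k v (bLabel j y) v≡ _ = ≤-trans (≤-reflexive (count-none (isEdge G v) λ w e →
      contradiction (subst (λ z → up z (toNode w) ≡ true) v≡ (edge-up v w e)) λ ())) z≤n

    -- The row of the hub costs at most `n`. Every other row has at most `k` edges of cost `1 / k`,
    -- hence costs at most 1.
    lpValue≤ : lpValue I capacity ≤ℚ ℕ→ℚ (n + n)
    lpValue≤ = ℚ.≤-trans (sumFin-≤ {g = bound} row) (ℕ→ℚ-mono (+-monoʳ-≤ n (≤-trans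
      (≤-reflexive (trans (sum-const (4 * (m * k)) 1) (*-identityʳ _))) (n≤1+n _))))
      where
      bound : Fin n → ℕ
      bound zero    = n
      bound (suc _) = 1
      row : ∀ v → sumFin (λ w → if isEdge G v w then capacity v w else 0ℚ) ≤ℚ ℕ→ℚ (bound v)
      row v = ℚ.≤-trans (ℚ.≤-reflexive (sumFin-indicator (isEdge G v) (cost (toNode v)))) (rowCount v)
        where
        rowCount : ∀ v → ℕ→ℚ (count (isEdge G v)) *ℚ cost (toNode v) ≤ℚ ℕ→ℚ (bound v)
        rowCount zero = ℚ.≤-trans
          (ℚ.≤-reflexive (trans (cong (ℕ→ℚ (count (isEdge G zero)) *ℚ_) (cong cost toNode-zero)) (ℚ.*-identityʳ _)))
          (ℕ→ℚ-mono (≤-trans (sum-≤-const {c = 1} (λ w → 𝟙≤1 (isEdge G zero w))) (≤-reflexive (*-identityʳ n))))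
          where
          𝟙≤1 : ∀ b → 𝟙 b ≤ 1
          𝟙≤1 true  = ≤-refl
          𝟙≤1 false = z≤n
        rowCount (suc v) = subst (λ q → ℕ→ℚ (count (isEdge G (suc v))) *ℚ q ≤ℚ 1ℚ)
          (sym (cong (λ b → if b then κ else 1ℚ) (nonHub-suc v)))
          (a*κ≤1 (upDegree≤k (suc v) _ refl (toNode-suc v)))

-- Powers, and the passage from natural numbers to rationals.

^-distribʳ-* : ∀ x y t → (x * y) ^ t ≡ x ^ t * y ^ t
^-distribʳ-* x y zero    = refl
^-distribʳ-* x y (suc t) = trans (cong (x * y *_) (^-distribʳ-* x y t))
  (interchange *-commutativeSemigroup x y (x ^ t) (y ^ t))

^ℚ-distribʳ-* : ∀ x y t → (x *ℚ y) ^ℚ t ≡ (x ^ℚ t) *ℚ (y ^ℚ t)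
^ℚ-distribʳ-* x y zero    = refl
^ℚ-distribʳ-* x y (suc t) = trans (cong (x *ℚ y *ℚ_) (^ℚ-distribʳ-* x y t))
  (interchange (record { isCommutativeSemigroup = record { isSemigroup = ℚ.*-isSemigroup ; comm = ℚ.*-comm } })
    x y (x ^ℚ t) (y ^ℚ t))

1^ℚ : ∀ t → 1ℚ ^ℚ t ≡ 1ℚ
1^ℚ zero    = refl
1^ℚ (suc t) = trans (ℚ.*-identityˡ _) (1^ℚ t)

ℕ→ℚ-^ : ∀ x t → ℕ→ℚ (x ^ t) ≡ ℕ→ℚ x ^ℚ t
ℕ→ℚ-^ x zero    = refl
ℕ→ℚ-^ x (suc t) = trans (ℕ→ℚ-* x (x ^ t)) (cong (ℕ→ℚ x *ℚ_) (ℕ→ℚ-^ x t))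

^ℚ-nonNeg : ∀ x t → 0ℚ ≤ℚ x → NonNegative (x ^ℚ t)
^ℚ-nonNeg x zero    0≤x = _
^ℚ-nonNeg x (suc t) 0≤x = ℚ.nonNeg*nonNeg⇒nonNeg x {{ℚ.nonNegative 0≤x}} (x ^ℚ t) {{^ℚ-nonNeg x t 0≤x}}

^ℚ-mono : ∀ {x y} t → 0ℚ ≤ℚ x → x ≤ℚ y → x ^ℚ t ≤ℚ y ^ℚ t
^ℚ-mono         zero    0≤x x≤y = ℚ.≤-refl
^ℚ-mono {x} {y} (suc t) 0≤x x≤y = ℚ.≤-trans
  (ℚ.*-monoʳ-≤-nonNeg (x ^ℚ t) {{^ℚ-nonNeg x t 0≤x}} x≤y)
  (ℚ.*-monoˡ-≤-nonNeg y {{ℚ.nonNegative (ℚ.≤-trans 0≤x x≤y)}} (^ℚ-mono t 0≤x x≤y))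

-- The LP value is first replaced by its integer bound `M`; then the integer inequality applies, and
-- its factor `Q ^ t` cancels against the power of the reciprocal.
gap-ℚ : ∀ Q .{{_ : NonZero Q}} n M e b t u {lp} → 0ℚ ≤ℚ lp → lp ≤ℚ ℕ→ℚ M →
        n ^ b * M ^ t ≤ Q ^ t * (e ^ t * n ^ u) →
        ((reciprocal Q ^ℚ t) *ℚ (ℕ→ℚ n ^ℚ b)) *ℚ (lp ^ℚ t) ≤ℚ (ℕ→ℚ e ^ℚ t) *ℚ (ℕ→ℚ n ^ℚ u)
gap-ℚ Q n M e b t u {lp} 0≤lp lp≤M ineq = begin
  ((C ^ℚ t) *ℚ (ℕ→ℚ n ^ℚ b)) *ℚ (lp ^ℚ t)
    ≡⟨ ℚ.*-assoc (C ^ℚ t) (ℕ→ℚ n ^ℚ b) (lp ^ℚ t) ⟩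
  (C ^ℚ t) *ℚ ((ℕ→ℚ n ^ℚ b) *ℚ (lp ^ℚ t))
    ≤⟨ ℚ.*-monoˡ-≤-nonNeg (C ^ℚ t) {{^ℚ-nonNeg C t 0≤C}}
         (ℚ.*-monoˡ-≤-nonNeg (ℕ→ℚ n ^ℚ b) {{^ℚ-nonNeg (ℕ→ℚ n) b (0≤ℕ→ℚ n)}} (^ℚ-mono t 0≤lp lp≤M)) ⟩
  (C ^ℚ t) *ℚ ((ℕ→ℚ n ^ℚ b) *ℚ (ℕ→ℚ M ^ℚ t))
    ≡⟨ cong ((C ^ℚ t) *ℚ_) (trans (cong₂ _*ℚ_ (sym (ℕ→ℚ-^ n b)) (sym (ℕ→ℚ-^ M t))) (sym (ℕ→ℚ-* (n ^ b) (M ^ t)))) ⟩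
  (C ^ℚ t) *ℚ ℕ→ℚ (n ^ b * M ^ t)
    ≤⟨ ℚ.*-monoˡ-≤-nonNeg (C ^ℚ t) {{^ℚ-nonNeg C t 0≤C}} (ℕ→ℚ-mono ineq) ⟩
  (C ^ℚ t) *ℚ ℕ→ℚ (Q ^ t * (e ^ t * n ^ u))
    ≡⟨ cong ((C ^ℚ t) *ℚ_) (trans (ℕ→ℚ-* (Q ^ t) (e ^ t * n ^ u)) (cong₂ _*ℚ_ (ℕ→ℚ-^ Q t)
         (trans (ℕ→ℚ-* (e ^ t) (n ^ u)) (cong₂ _*ℚ_ (ℕ→ℚ-^ e t) (ℕ→ℚ-^ n u))))) ⟩
  (C ^ℚ t) *ℚ ((ℕ→ℚ Q ^ℚ t) *ℚ ((ℕ→ℚ e ^ℚ t) *ℚ (ℕ→ℚ n ^ℚ u)))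
    ≡⟨ sym (ℚ.*-assoc (C ^ℚ t) (ℕ→ℚ Q ^ℚ t) _) ⟩
  ((C ^ℚ t) *ℚ (ℕ→ℚ Q ^ℚ t)) *ℚ ((ℕ→ℚ e ^ℚ t) *ℚ (ℕ→ℚ n ^ℚ u))
    ≡⟨ cong (_*ℚ ((ℕ→ℚ e ^ℚ t) *ℚ (ℕ→ℚ n ^ℚ u))) unitC ⟩
  1ℚ *ℚ ((ℕ→ℚ e ^ℚ t) *ℚ (ℕ→ℚ n ^ℚ u))
    ≡⟨ ℚ.*-identityˡ _ ⟩
  (ℕ→ℚ e ^ℚ t) *ℚ (ℕ→ℚ n ^ℚ u) ∎
  where
  open ℚ.≤-Reasoning
  C : ℚ
  C = reciprocal Q
  0≤C : 0ℚ ≤ℚ C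
  0≤C = ℚ.nonNegative⁻¹ C {{ℚ.pos⇒nonNeg C {{reciprocal-pos Q}}}}
  0≤ℕ→ℚ : ∀ a → 0ℚ ≤ℚ ℕ→ℚ a
  0≤ℕ→ℚ a = ℚ.nonNegative⁻¹ (ℕ→ℚ a) {{ℕ→ℚ-nonNeg a}}
  unitC : (C ^ℚ t) *ℚ (ℕ→ℚ Q ^ℚ t) ≡ 1ℚ
  unitC = trans (sym (^ℚ-distribʳ-* C (ℕ→ℚ Q) t))
    (trans (cong (_^ℚ t) (trans (ℚ.*-comm C (ℕ→ℚ Q)) (*-reciprocal Q))) (1^ℚ t))

-- Choice of parameters.

inverseConstant : ℕ → ℕ
inverseConstant b = 81 * suc (b + b) * 18

-- With g = 2b + 1, L = ℓ², d = Lᵇ and k = L d² = L^g, the number of vertices is O(h k) = O(L d³), where L ≤ n^(1/b).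
module Parameters (b ℓ : ℕ) .{{_ : NonZero ℓ}} (18g≤ℓ : 18 * suc (b + b) ≤ ℓ) where

  g L d k h : ℕ
  g = suc (b + b)
  L = ℓ * ℓ
  d = L ^ b
  k = L ^ g
  h = 9 * (g * d)

  instance
    L≢0 : NonZero L
    L≢0 = m*n≢0 ℓ ℓ
    d≢0 : NonZero d
    d≢0 = m^n≢0 L b
    k≢0 : NonZero k
    k≢0 = m^n≢0 L g
    gd≢0 : NonZero (g * d)
    gd≢0 = m*n≢0 g d
    h≢0 : NonZero h
    h≢0 = m*n≢0 9 (g * d)

  Ld²≡k : L * (d * d) ≡ k
  Ld²≡k = cong (L *_) (sym (^-distribˡ-+-* L b b))

  18≤ℓ : 18 ≤ ℓ
  18≤ℓ = ≤-trans (m≤m*n 18 g) 18g≤ℓ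

  ℓ≤k : ℓ ≤ k
  ℓ≤k = ≤-trans (m≤m*n ℓ ℓ) (m≤m*n L (L ^ (b + b)) {{m^n≢0 L (b + b)}})

  d≤k : d ≤ k
  d≤k = ^-monoʳ-≤ L (m≤n⇒m≤1+n (m≤m+n b b))

  m≤k : h + h ≤ k
  m≤k = begin
    h + h              ≡⟨ solve 2 (λ g d → con 9 :* (g :* d) :+ con 9 :* (g :* d) := con 18 :* g :* d) refl g d ⟩
    18 * g * d         ≤⟨ *-mono-≤ 18g≤ℓ (≤-trans (m≤m*n d d) (m≤n*m (d * d) ℓ)) ⟩
    ℓ * (ℓ * (d * d))  ≡⟨ sym (*-assoc ℓ ℓ (d * d)) ⟩
    L * (d * d)        ≡⟨ Ld²≡k ⟩
    k                  ∎
    where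
    open ≤-Reasoning
    open +-*-Solver

  k≤4mk : k ≤ 4 * ((h + h) * k)
  k≤4mk = ≤-trans (m≤n*m k (h + h) {{>-nonZero (≤-trans (>-nonZero⁻¹ h) (m≤m+n h h))}}) (m≤n*m ((h + h) * k) 4)

  -- As `L` is the square of `ℓ`, the right side splits into two powers `ℓ ^ (h * h)`. One absorbs
  -- `16 ^ (h * h)`. The other beats the number of label choices, whose exponent `8 * (g * d * h)`
  -- is below `h * h` because of the 9 in `h`.
  large : 2 ^ ((h + h) * (h + h)) * (k ^ ((h + h) * d) * k ^ ((h + h) * d)) < L ^ (h * h)
  large = begin-strict
    2 ^ ((h + h) * (h + h)) * (k ^ (m * d) * k ^ (m * d))  ≤⟨ *-monoˡ-≤ _ pow2 ⟩
    ℓ ^ (h * h) * (k ^ (m * d) * k ^ (m * d))              ≡⟨ cong (ℓ ^ (h * h) *_) configurations ⟩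
    ℓ ^ (h * h) * ℓ ^ (8 * (g * d * h))                    <⟨ *-monoʳ-< (ℓ ^ (h * h)) {{m^n≢0 ℓ (h * h)}}
                                                                (^-monoʳ-< ℓ (≤-trans (s≤s (s≤s z≤n)) 18≤ℓ) exponents) ⟩
    ℓ ^ (h * h) * ℓ ^ (h * h)  ≡⟨ sym (^-distribʳ-* ℓ ℓ (h * h)) ⟩
    L ^ (h * h)                ∎
    where
    open ≤-Reasoning
    open +-*-Solver
    m : ℕ
    m = h + h
    pow2 : 2 ^ (m * m) ≤ ℓ ^ (h * h)
    pow2 = begin
      2 ^ (m * m)        ≡⟨ cong (2 ^_) (solve 1 (λ h → (h :+ h) :* (h :+ h) := con 4 :* (h :* h)) refl h) ⟩
      2 ^ (4 * (h * h))  ≡⟨ sym (^-*-assoc 2 4 (h * h)) ⟩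
      16 ^ (h * h)       ≤⟨ ^-monoˡ-≤ (h * h) (≤-trans (m≤n+m 16 2) 18≤ℓ) ⟩
      ℓ ^ (h * h)        ∎
    configurations : k ^ (m * d) * k ^ (m * d) ≡ ℓ ^ (8 * (g * d * h))
    configurations = begin-equality
      k ^ (m * d) * k ^ (m * d)                              ≡⟨ sym (^-distribˡ-+-* k (m * d) (m * d)) ⟩
      (L ^ g) ^ (m * d + m * d)                              ≡⟨ ^-*-assoc L g (m * d + m * d) ⟩
      L ^ (g * (m * d + m * d))                              ≡⟨ ^-distribʳ-* ℓ ℓ (g * (m * d + m * d)) ⟩
      ℓ ^ (g * (m * d + m * d)) * ℓ ^ (g * (m * d + m * d))  ≡⟨ sym (^-distribˡ-+-* ℓ (g * (m * d + m * d)) _) ⟩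
      ℓ ^ (g * (m * d + m * d) + g * (m * d + m * d))        ≡⟨ cong (ℓ ^_) (solve 3 (λ g d h →
        g :* ((h :+ h) :* d :+ (h :+ h) :* d) :+ g :* ((h :+ h) :* d :+ (h :+ h) :* d) := con 8 :* (g :* d :* h)) refl g d h) ⟩
      ℓ ^ (8 * (g * d * h))                          ∎
    exponents : 8 * (g * d * h) < h * h
    exponents = begin-strict
      8 * (g * d * h)  <⟨ *-monoˡ-< (g * d * h) {{m*n≢0 (g * d) h}} (n<1+n 8) ⟩
      9 * (g * d * h)  ≡⟨ sym (*-assoc 9 (g * d) h) ⟩
      h * h            ∎

  -- From `e ≥ h k d` and `2n ≤ 18 h k` the gap is at least `d / 18`, while `n ≤ 81 g L d^3` bounds
  -- `n ^ b` by a constant times `L ^ b * d ^ (3 * b)`. The surplus `L ^ b` is at most `n`, hence at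
  -- most `n ^ (3 * a)` as `a` is positive.
  gap-ℕ : ∀ a e → 0 < a → k * (h * d) ≤ e →
          let n = suc (4 * ((h + h) * k)) in
          n ^ b * (n + n) ^ (3 * b) ≤ inverseConstant b ^ (3 * b) * (e ^ (3 * b) * n ^ (3 * a))
  gap-ℕ a e 0<a cheap = begin
    n ^ b * (n + n) ^ (3 * b)
      ≤⟨ *-mono-≤ vertices (^-monoˡ-≤ (3 * b) 2n≤) ⟩
    ((81 * g) ^ (3 * b) * n ^ (3 * a) * d ^ (3 * b)) * (18 * (h * k)) ^ (3 * b)
      ≡⟨ cong ((81 * g) ^ (3 * b) * n ^ (3 * a) * d ^ (3 * b) *_) (^-distribʳ-* 18 (h * k) (3 * b)) ⟩
    ((81 * g) ^ (3 * b) * n ^ (3 * a) * d ^ (3 * b)) * (18 ^ (3 * b) * (h * k) ^ (3 * b))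
      ≡⟨ solve 5 (λ A B C D E → A :* B :* C :* (D :* E) := A :* D :* (E :* C :* B)) refl
           ((81 * g) ^ (3 * b)) (n ^ (3 * a)) (d ^ (3 * b)) (18 ^ (3 * b)) ((h * k) ^ (3 * b)) ⟩
    ((81 * g) ^ (3 * b) * 18 ^ (3 * b)) * ((h * k) ^ (3 * b) * d ^ (3 * b) * n ^ (3 * a))
      ≡⟨ sym (cong₂ (λ x y → x * (y * n ^ (3 * a))) (^-distribʳ-* (81 * g) 18 (3 * b)) (^-distribʳ-* (h * k) d (3 * b))) ⟩
    inverseConstant b ^ (3 * b) * ((h * k * d) ^ (3 * b) * n ^ (3 * a))
      ≤⟨ *-monoʳ-≤ (inverseConstant b ^ (3 * b)) (*-monoˡ-≤ (n ^ (3 * a)) (^-monoˡ-≤ (3 * b) hkd≤e)) ⟩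
    inverseConstant b ^ (3 * b) * (e ^ (3 * b) * n ^ (3 * a)) ∎
    where
    open ≤-Reasoning
    open +-*-Solver
    n : ℕ
    n = suc (4 * ((h + h) * k))
    hkd≤e : h * k * d ≤ e
    hkd≤e = ≤-trans (≤-reflexive (solve 3 (λ h k d → h :* k :* d := k :* (h :* d)) refl h k d)) cheap
    n≤ : n ≤ 9 * (h * k)
    n≤ = begin
      1 + 4 * ((h + h) * k)      ≤⟨ +-monoˡ-≤ _ (>-nonZero⁻¹ (h * k) {{m*n≢0 h k}}) ⟩
      h * k + 4 * ((h + h) * k)  ≡⟨ solve 2 (λ h k → h :* k :+ con 4 :* ((h :+ h) :* k) := con 9 :* (h :* k)) refl h k ⟩
      9 * (h * k)                ∎
    2n≤ : n + n ≤ 18 * (h * k)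
    2n≤ = ≤-trans (+-mono-≤ n≤ n≤)
      (≤-reflexive (solve 1 (λ x → con 9 :* x :+ con 9 :* x := con 18 :* x) refl (h * k)))
    d≤n^3a : d ≤ n ^ (3 * a)
    d≤n^3a = ≤-trans (≤-trans d≤k (m≤n⇒m≤1+n k≤4mk)) (≤-trans (≤-reflexive (sym (^-identityʳ n)))
      (^-monoʳ-≤ n (≤-trans 0<a (m≤n*m a 3))))
    vertices : n ^ b ≤ (81 * g) ^ (3 * b) * n ^ (3 * a) * d ^ (3 * b)
    vertices = begin
      n ^ b              ≤⟨ ^-monoˡ-≤ b n≤ ⟩
      (9 * (h * k)) ^ b  ≡⟨ cong (_^ b) (trans (cong (λ k → 9 * (h * k)) (sym Ld²≡k))
        (solve 3 (λ g d L → con 9 :* (con 9 :* (g :* d) :* (L :* (d :* d))) := con 81 :* g :* L :* (d :* (d :* (d :* con 1)))) refl g d L)) ⟩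
      (81 * g * L * d ^ 3) ^ b                        ≡⟨ ^-distribʳ-* (81 * g * L) (d ^ 3) b ⟩
      (81 * g * L) ^ b * (d ^ 3) ^ b                  ≡⟨ cong₂ _*_ (^-distribʳ-* (81 * g) L b) (^-*-assoc d 3 b) ⟩
      -- The middle factor `d` is `L ^ b` by definition.
      (81 * g) ^ b * d * d ^ (3 * b)                  ≤⟨ *-monoˡ-≤ (d ^ (3 * b)) (*-mono-≤ (^-monoʳ-≤ (81 * g) (m≤n*m b 3)) d≤n^3a) ⟩
      (81 * g) ^ (3 * b) * n ^ (3 * a) * d ^ (3 * b)  ∎

-- Assembly of the integrality gap.

record GapInstance (n lower : ℕ) : Set where
  field
    inst        : Instance
    size        : Instance.n inst ≡ n
    capacity    : Fin (Instance.n inst) → Fin (Instance.n inst) → ℚ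
    flow        : Fin (Instance.n inst) → Fin (Instance.n inst) → FlowList inst
    feasible    : LPFeasible inst capacity flow
    lp-nonNeg   : 0ℚ ≤ℚ lpValue inst capacity
    lp≤         : lpValue inst capacity ≤ℚ ℕ→ℚ (n + n)
    edgeCount≥  : ∀ H → IsSubgraph inst H → SafelyConnected inst H → lower ≤ edgeCount H

gapInstance : ∀ {k} .{{_ : NonZero k}} L d h .{{_ : NonZero L}} → L * (d * d) ≤ k → h + h ≤ k →
              2 ^ ((h + h) * (h + h)) * (k ^ ((h + h) * d) * k ^ ((h + h) * d)) < L ^ (h * h) →
              GapInstance (suc (4 * ((h + h) * k))) (k * (h * d))
gapInstance {k} L d h Ld²≤k 2h≤k large = record
  { inst       = I
  ; size       = refl
  ; capacity   = capacity
  ; flow       = flow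
  ; feasible   = lpFeasible
  ; lp-nonNeg  = 0≤lpValue
  ; lp≤        = lpValue≤ 2h≤k
  ; edgeCount≥ = λ H H⊆G conn → let open LowerBound H H⊆G conn in
      -- For every terminal index `r` the neighbourhoods of the terminals of that index cost at
      -- least `h * d`; there are `k` indices.
      ≤-trans (sum-≥-const λ r → cost≥
        (λ i → isEdge H (fromNode (aTerm i r))) (λ j → isEdge H (fromNode (bTerm j r))) (label ∘ toNode)
        λ i j → served (toNode-fromNode _) (toNode-fromNode _)) edgeCount≥
  }
  where
  open Shifts L d h Ld²≤k large using (shift; cost≥)
  open Construction (h + h) k shift
  open Fractional (h + h) k shift

GapInstance⇒gap : ∀ {n lower N} Q .{{_ : NonZero Q}} a b → GapInstance n lower → N ≤ n →
                  (∀ e → lower ≤ e → n ^ b * (n + n) ^ (3 * b) ≤ Q ^ (3 * b) * (e ^ (3 * b) * n ^ (3 * a))) →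
                  Σ Instance λ I → (N ≤ Instance.n I) ×
                  Σ (Fin (Instance.n I) → Fin (Instance.n I) → ℚ) λ c →
                  Σ (Fin (Instance.n I) → Fin (Instance.n I) → FlowList I) λ f →
                  LPFeasible I c f ×
                  ((H : Adj (Instance.n I)) → IsSubgraph I H → SafelyConnected I H →
                  ((reciprocal Q ^ℚ (3 * b)) *ℚ (ℕ→ℚ (Instance.n I) ^ℚ b)) *ℚ (lpValue I c ^ℚ (3 * b))
                  ≤ℚ (ℕ→ℚ (edgeCount H) ^ℚ (3 * b)) *ℚ (ℕ→ℚ (Instance.n I) ^ℚ (3 * a)))
GapInstance⇒gap Q a b record { inst = I ; size = refl ; capacity = c ; flow = f ; feasible = feas
                             ; lp-nonNeg = 0≤lp ; lp≤ = lp≤ ; edgeCount≥ = edges≥ } N≤n ineq =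
  I , N≤n , c , f , feas , λ H H⊆G conn →
    gap-ℚ Q _ _ (edgeCount H) b (3 * b) (3 * a) 0≤lp lp≤ (ineq (edgeCount H) (edges≥ H H⊆G conn))

-- With epsilon equal to `a / b`, the final inequality is the bound `C n^(1/3 - a/b) lp ≤ |E(H)|`
-- raised to the power `3 * b`, which leaves only natural exponents. Any feasible LP solution
-- serves, since the optimum is no larger.
theorem21 : (a b : ℕ) → 0 < a → 0 < b →
    Σ ℚ λ C → Positive C × ((N : ℕ) → Σ Instance λ I → (N ≤ Instance.n I) ×
    Σ (Fin (Instance.n I) → Fin (Instance.n I) → ℚ) λ c →
    Σ (Fin (Instance.n I) → Fin (Instance.n I) → FlowList I) λ f →
    LPFeasible I c f ×
    ((H : Adj (Instance.n I)) → IsSubgraph I H → SafelyConnected I H →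
    ((C ^ℚ (3 * b)) *ℚ (ℕ→ℚ (Instance.n I) ^ℚ b)) *ℚ (lpValue I c ^ℚ (3 * b))
    ≤ℚ (ℕ→ℚ (edgeCount H) ^ℚ (3 * b)) *ℚ (ℕ→ℚ (Instance.n I) ^ℚ (3 * a))))
theorem21 a b 0<a _ = reciprocal (inverseConstant b) , reciprocal-pos (inverseConstant b) , λ N →
  -- The first summand meets the requirement on `ℓ`; the second makes the number of vertices at
  -- least `N`.
  let ℓ = 18 * suc (b + b) + N
      open Parameters b ℓ (m≤m+n (18 * suc (b + b)) N)
  in GapInstance⇒gap (inverseConstant b) a b (gapInstance L d h (≤-reflexive Ld²≡k) m≤k large)
       (≤-trans (≤-trans (m≤n+m N (18 * suc (b + b))) ℓ≤k) (m≤n⇒m≤1+n k≤4mk)) (λ e → gap-ℕ a e 0<a)
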